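{- Let $n>1$ and let $NC(10n+1,5)$ be the number of non-isomorphic cyclic $(K_{10n+1},C_5)$-designs. Then there is an integer $N$ such that for all $n\ge N$: - if $n\not\equiv 4\pmod 7$, then $NC(10n+1,5)\ge (29.7)^n$; - if $n\equiv 4\pmod 7$, then $NC(10n+1,5)\ge (38.4)^n$.
   Context: A $(K_v,C_k)$-design (or $k$-cycle system of the complete graph $K_v$) is a set $\mathcal{B}$ of $k$-cycles of $K_v$ whose edges partition the edge-set of $K_v$. It is cyclic if the vertex-set can be identified with $\mathbb{Z}_v$ in such a way that $B=(b_1,\dots,b_k)\in\mathcal{B}$ implies $B+z=(b_1+z,\dots,b_k+z)\in\mathcal{B}$ for all $z\in\mathbb{Z}_v$. Two $(K_v,C_k)$-designs with cycle sets $\mathcal{B}$ and $\mathcal{B}'$ are isomorphic if there is a permutation of the vertex-set turning $\mathcal{B}$ into $\mathcal{B}'$. $NC(v,k)$ is the number of cyclic $(K_v,C_k)$-designs up to isomorphism. -}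

module Defs where

open import Data.Empty using (⊥)
open import Data.Fin.Base using (Fin; toℕ; zero; suc)
open import Data.Fin.Permutation as Perm
  using (Permutation′; _⟨$⟩ʳ_; _⟨$⟩ˡ_; _∘ₚ_; permutation)
open import Data.Fin.Properties as Fin using (nonZeroIndex; toℕ-injective; toℕ<n; toℕ-fromℕ<)
open import Data.List.Base using (List; []; _∷_; _++_; map; length; lookup; filter; concatMap;
  allFin; cartesianProduct; cartesianProductWith; deduplicate)
open import Data.List.Relation.Unary.All as All using (All; []; _∷_)
open import Data.List.Relation.Unary.AllPairs using (AllPairs; []; _∷_)
open import Data.List.Relation.Unary.Any as Any using (Any; here; there)
import Data.List.Relation.Unary.Any.Properties as Anyₚ
open import Data.List.Relation.Unary.Enumerates.Setoid using (IsEnumeration)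
import Data.List.Relation.Unary.Enumerates.Setoid.Properties as Enum
open import Data.List.Relation.Unary.Unique.DecSetoid.Properties using (deduplicate-!)
import Data.List.Membership.Propositional as Prop
import Data.List.Membership.Propositional.Properties as Propₚ
import Data.List.Membership.Setoid as Membership
import Data.List.Membership.Setoid.Properties as Membershipₚ
open import Data.Nat.Base using (ℕ; zero; suc; _+_; _∸_; _≤_; NonZero)
open import Data.Nat.DivMod using (_mod_; _%_; %-distribˡ-+; m%n%n≡m%n; [m+n]%n≡m%n; m<n⇒m%n≡m; m%n<n)
import Data.Nat.Properties as ℕ
open import Data.Product.Base using (Σ; ∃; _×_; _,_; proj₁; proj₂)
open import Data.Product.Relation.Binary.Pointwise.NonDependent using (_×ₛ_)
open import Data.Vec.Functional using () renaming (_∷_ to cons)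
open import Function.Base using (_∘_; _on_)
open import Function.Bundles using (Inverse; Equivalence; _⇔_; mk⇔)
open import Function.Definitions using (Injective)
open import Function.Properties.Equivalence using (⇔-isEquivalence)
open import Level using (Level; 0ℓ)
open import Relation.Binary.Bundles using (Setoid; DecSetoid)
open import Relation.Binary.Definitions using (_Respects_)
open import Relation.Binary.PropositionalEquality
  using (_≡_; _≢_; _≗_; refl; sym; trans; cong; subst; subst₂; setoid; _→-setoid_; module ≡-Reasoning)
open import Relation.Binary.Structures using (IsEquivalence)
import Relation.Binary.Construct.On as On
open import Relation.Nullary.Decidable
  using (Dec; yes; no; map′; _×-dec_; _⊎-dec_; _→-dec_; ¬?)
open import Relation.Nullary.Negation using (contradiction)
open import Relation.Unary using (Decidable)
open import Data.Sum.Base using (_⊎_; inj₁; inj₂)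

private
  variable
    v k : ℕ

next : Fin k → Fin k
next i = let instance _ = nonZeroIndex i in suc (toℕ i) mod _

-- A representation (b₀, …, b_{k-1}) of a k-cycle of K_v.

record Cycle (v k : ℕ) : Set where
  field
    3≤k       : 3 ≤ k
    vertex    : Fin k → Fin v
    injective : Injective _≡_ _≡_ vertex

open Cycle public

data Edge (B : Cycle v k) : Fin v → Fin v → Set where
  forward  : ∀ i → Edge B (vertex B i) (vertex B (next i))
  backward : ∀ i → Edge B (vertex B (next i)) (vertex B i)

-- A cycle is a subgraph of K_v: the choice of a starting point and of a
-- direction is immaterial.

infix 4 _≈ᶜ_

record _≈ᶜ_ (B C : Cycle v k) : Set where
  constructor mk≈ᶜ
  field
    edges : ∀ x y → Edge B x y ⇔ Edge C x y

open _≈ᶜ_ public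

cycleSetoid : ℕ → ℕ → Setoid 0ℓ 0ℓ
cycleSetoid v k = record
  { Carrier       = Cycle v k
  ; _≈_           = _≈ᶜ_
  ; isEquivalence = record
    { refl  = mk≈ᶜ λ _ _ → ⇔.refl
    ; sym   = λ p → mk≈ᶜ λ x y → ⇔.sym (edges p x y)
    ; trans = λ p q → mk≈ᶜ λ x y → ⇔.trans (edges p x y) (edges q x y)
    }
  }
  where module ⇔ = IsEquivalence (⇔-isEquivalence {0ℓ})

module _ {v k : ℕ} where
  open Membership (cycleSetoid v k) public using (_∈_)
  open Setoid (cycleSetoid v k) public using ()
    renaming (refl to ≈ᶜ-refl; sym to ≈ᶜ-sym; trans to ≈ᶜ-trans)

infixr 8 _·_

_·_ : Permutation′ v → Cycle v k → Cycle v k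
π · B = record
  { 3≤k       = 3≤k B
  ; vertex    = λ i → π ⟨$⟩ʳ vertex B i
  ; injective = λ eq → injective B
      (trans (sym (Perm.inverseˡ π)) (trans (cong (π ⟨$⟩ˡ_) eq) (Perm.inverseˡ π)))
  }

-- The list stands for the set of its members up to _≈ᶜ_; order and
-- repetitions carry no information.

record IsDesign (Bs : List (Cycle v k)) : Set where
  field
    covered  : ∀ x y → x ≢ y → Any (λ B → Edge B x y) Bs
    disjoint : ∀ B C → B ∈ Bs → C ∈ Bs → ∀ x y → Edge B x y → Edge C x y → B ≈ᶜ C

open IsDesign public

record Design (v k : ℕ) : Set where
  constructor design
  field
    cycles   : List (Cycle v k)
    isDesign : IsDesign cycles

open Design public

private
  %-absorbˡ : ∀ a b d .{{_ : NonZero d}} → (a % d + b) % d ≡ (a + b) % d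
  %-absorbˡ a b d = begin
    (a % d + b) % d          ≡⟨ %-distribˡ-+ (a % d) b d ⟩
    (a % d % d + b % d) % d  ≡⟨ cong (λ m → (m + b % d) % d) (m%n%n≡m%n a d) ⟩
    (a % d + b % d) % d      ≡⟨ %-distribˡ-+ a b d ⟨
    (a + b) % d              ∎
    where open ≡-Reasoning

  mod-cancel : ∀ {a b} .{{_ : NonZero v}} → a + b ≡ v → (x : Fin v) →
               (toℕ ((toℕ x + a) mod v) + b) mod v ≡ x
  mod-cancel {v} {a} {b} a+b≡v x = toℕ-injective (begin
    toℕ ((toℕ ((toℕ x + a) mod v) + b) mod v)  ≡⟨ toℕ-fromℕ< (m%n<n (toℕ ((toℕ x + a) mod v) + b) v) ⟩
    (toℕ ((toℕ x + a) mod v) + b) % v          ≡⟨ cong (λ m → (m + b) % v) (toℕ-fromℕ< (m%n<n (toℕ x + a) v)) ⟩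
    ((toℕ x + a) % v + b) % v                  ≡⟨ %-absorbˡ (toℕ x + a) b v ⟩
    (toℕ x + a + b) % v                        ≡⟨ cong (_% v) (ℕ.+-assoc (toℕ x) a b) ⟩
    (toℕ x + (a + b)) % v                      ≡⟨ cong (λ m → (toℕ x + m) % v) a+b≡v ⟩
    (toℕ x + v) % v                            ≡⟨ [m+n]%n≡m%n (toℕ x) v ⟩
    toℕ x % v                                  ≡⟨ m<n⇒m%n≡m (toℕ<n x) ⟩
    toℕ x                                      ∎)
    where open ≡-Reasoning

-- x ↦ x + z, with Fin v read as ℤ/v.

translation : Fin v → Permutation′ v
translation {v} z = let instance _ = nonZeroIndex z in permutation
  (λ x → (toℕ x + toℕ z) mod v)
  (λ x → (toℕ x + (v ∸ toℕ z)) mod v)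
  (mod-cancel (ℕ.m∸n+n≡m z≤v))
  (mod-cancel (ℕ.m+[n∸m]≡n z≤v))
  where z≤v = ℕ.<⇒≤ (toℕ<n z)

-- φ is the identification of the vertex set with ℤ/v.

IsCyclic : Design v k → Set
IsCyclic {v} {k} D = ∃ λ (φ : Permutation′ v) → ∀ z (B : Cycle v k) →
  B ∈ cycles D → (φ ∘ₚ translation z ∘ₚ Perm.flip φ) · B ∈ cycles D

CyclicDesign : ℕ → ℕ → Set
CyclicDesign v k = Σ (Design v k) IsCyclic

Isomorphic : Design v k → Design v k → Set
Isomorphic {v} {k} D E = ∃ λ (π : Permutation′ v) → ∀ (B : Cycle v k) →
  B ∈ cycles D ⇔ π · B ∈ cycles E

∈-resp : {B C : Cycle v k} {Bs : List (Cycle v k)} → B ≈ᶜ C → B ∈ Bs → C ∈ Bs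
∈-resp = Membershipₚ.∈-resp-≈ (cycleSetoid _ _)

≗⇒≈ᶜ : {B C : Cycle v k} → vertex B ≗ vertex C → B ≈ᶜ C
≗⇒≈ᶜ B≗C = mk≈ᶜ λ x y → mk⇔ (go B≗C) (go (sym ∘ B≗C))
  where
  go : {B C : Cycle v k} → vertex B ≗ vertex C → ∀ {x y} → Edge B x y → Edge C x y
  go {C = C} eq (forward i)  = subst₂ (Edge C) (sym (eq i)) (sym (eq (next i))) (forward i)
  go {C = C} eq (backward i) = subst₂ (Edge C) (sym (eq (next i))) (sym (eq i)) (backward i)

·-edge : (π : Permutation′ v) {B : Cycle v k} {x y : Fin v} →
         Edge B x y → Edge (π · B) (π ⟨$⟩ʳ x) (π ⟨$⟩ʳ y)
·-edge π (forward i)  = forward i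
·-edge π (backward i) = backward i

·-congˡ : {π ρ : Permutation′ v} → π Perm.≈ ρ → (B : Cycle v k) → π · B ≈ᶜ ρ · B
·-congˡ π≈ρ B = ≗⇒≈ᶜ λ i → π≈ρ (vertex B i)

·-congʳ : (π : Permutation′ v) {B C : Cycle v k} → B ≈ᶜ C → π · B ≈ᶜ π · C
·-congʳ π {B} {C} B≈C = mk≈ᶜ λ x y → mk⇔ (go B≈C) (go (≈ᶜ-sym B≈C))
  where
  go : {B C : Cycle _ _} → B ≈ᶜ C → ∀ {x y} → Edge (π · B) x y → Edge (π · C) x y
  go B≈C (forward i)  = ·-edge π (Equivalence.to (edges B≈C _ _) (forward i))
  go B≈C (backward i) = ·-edge π (Equivalence.to (edges B≈C _ _) (backward i))

flip-· : (π : Permutation′ v) (B : Cycle v k) → π · Perm.flip π · B ≈ᶜ B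
flip-· π B = ≗⇒≈ᶜ λ i → Perm.inverseʳ π

flip-cong : {π ρ : Permutation′ v} → π Perm.≈ ρ → Perm.flip π Perm.≈ Perm.flip ρ
flip-cong {π = π} {ρ} π≈ρ x = begin
  π ⟨$⟩ˡ x                    ≡⟨ cong (π ⟨$⟩ˡ_) (Perm.inverseʳ ρ) ⟨
  π ⟨$⟩ˡ (ρ ⟨$⟩ʳ (ρ ⟨$⟩ˡ x))  ≡⟨ cong (π ⟨$⟩ˡ_) (π≈ρ _) ⟨
  π ⟨$⟩ˡ (π ⟨$⟩ʳ (ρ ⟨$⟩ˡ x))  ≡⟨ Perm.inverseˡ π ⟩
  ρ ⟨$⟩ˡ x                    ∎
  where open ≡-Reasoning

Isomorphic-isEquivalence : IsEquivalence (Isomorphic {v} {k})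
Isomorphic-isEquivalence = record
  { refl  = Perm.id , λ B → mk⇔ (∈-resp (≗⇒≈ᶜ λ _ → refl)) (∈-resp (≗⇒≈ᶜ λ _ → refl))
  ; sym   = λ (π , f) → Perm.flip π , λ B → mk⇔
      (Equivalence.from (f _) ∘ ∈-resp (≈ᶜ-sym (flip-· π B)))
      (∈-resp (flip-· π B) ∘ Equivalence.to (f _))
  ; trans = λ (π , f) (ρ , g) → π ∘ₚ ρ , λ B → mk⇔
      (∈-resp (≗⇒≈ᶜ λ _ → refl) ∘ Equivalence.to (g _) ∘ Equivalence.to (f B))
      (Equivalence.from (f B) ∘ Equivalence.from (g _) ∘ ∈-resp (≗⇒≈ᶜ λ _ → refl))
  }

cyclicDesignSetoid : ℕ → ℕ → Setoid 0ℓ 0ℓ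
cyclicDesignSetoid v k = record
  { Carrier       = CyclicDesign v k
  ; _≈_           = Isomorphic on proj₁
  ; isEquivalence = On.isEquivalence proj₁ Isomorphic-isEquivalence
  }

private
  variable
    a b p ℓ ℓ₁ ℓ₂ : Level

Finite : Setoid a ℓ → Set _
Finite S = ∃ (IsEnumeration S)

module _ (S : Setoid a ℓ) {P : Setoid.Carrier S → Set p} where
  open Setoid S using (_≈_)

  ∃? : Finite S → P Respects _≈_ → Decidable P → Dec (∃ P)
  ∃? (xs , enum) resp P? = map′ Any.satisfied (λ (x , px) → Membership.lose S resp (enum x) px)
    (Any.any? P? xs)

  ∀? : Finite S → P Respects _≈_ → Decidable P → Dec (∀ x → P x)
  ∀? (xs , enum) resp P? = map′ (λ ps x → All.lookupₛ S resp ps (enum x)) (λ f → All.tabulate (λ {x} _ → f x))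
    (All.all? P? xs)

-- T consists, up to its equality, of the mk x px with P x decidable.

module _ (S : Setoid a ℓ₁) (T : Setoid b ℓ₂) where
  private
    module S = Setoid S
    module T = Setoid T

  comprehension : {P : S.Carrier → Set p} → Finite S → Decidable P →
    (mk : ∀ x → P x → T.Carrier) →
    (∀ t → ∃ λ x → ∀ y → x S.≈ y → P y × (∀ py → t T.≈ mk y py)) →
    Finite T
  comprehension {P = P} (xs , enum) P? mk complete = concatMap pick xs , found
    where
    pickDec : ∀ x → Dec (P x) → List T.Carrier
    pickDec x (yes px) = mk x px ∷ []
    pickDec x (no _)   = []

    pick : S.Carrier → List T.Carrier
    pick x = pickDec x (P? x)

    found-pick : ∀ t y (py? : Dec (P y)) → P y × (∀ py → t T.≈ mk y py) →
                 Any (t T.≈_) (pickDec y py?)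
    found-pick t y (yes py) (_ , eq) = here (eq py)
    found-pick t y (no ¬py) (py , _) = contradiction py ¬py

    found : IsEnumeration T (concatMap pick xs)
    found t = let x , good = complete t in
      Anyₚ.concatMap⁺ pick (Any.map (λ {y} x≈y → found-pick t y (P? y) (good y x≈y)) (enum x))

module _ (S : Setoid a ℓ) where
  open Setoid S using (Carrier; _≈_) renaming (sym to ≈-sym)

  lookup-injective : ∀ {xs} → AllPairs (λ x y → x ≈ y → ⊥) xs →
                     ∀ i j → lookup xs i ≈ lookup xs j → i ≡ j
  lookup-injective (_ ∷ _)  zero    zero    _  = refl
  lookup-injective (x ∷ _)  zero    (suc j) eq = contradiction eq (All.lookup x (Propₚ.∈-lookup j))
  lookup-injective (x ∷ _)  (suc i) zero    eq = contradiction (≈-sym eq) (All.lookup x (Propₚ.∈-lookup i))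
  lookup-injective (_ ∷ xs) (suc i) (suc j) eq = cong suc (lookup-injective xs i j eq)

  cardinality : Finite S → (∀ x y → Dec (x ≈ y)) → ∃ λ c → Inverse S (setoid (Fin c))
  cardinality (xs , enum) _≟_ = length ys , record
    { to        = index
    ; from      = lookup ys
    ; to-cong   = λ {x} {y} x≈y → inj _ _ (trans′ (≈-sym (at x)) (trans′ x≈y (at y)))
    ; from-cong = λ { refl → refl′ }
    ; inverse   = (λ {i} {x} x≈i → inj _ _ (trans′ (≈-sym (at x)) x≈i))
                , (λ { {x} refl → ≈-sym (at x) })
    }
    where
    open Setoid S using () renaming (refl to refl′; trans to trans′)
    DS : DecSetoid a ℓ
    DS = record { isDecEquivalence = record { isEquivalence = Setoid.isEquivalence S ; _≟_ = _≟_ } }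
    ys    = deduplicate _≟_ xs
    inj   = lookup-injective (deduplicate-! DS xs)
    index : Carrier → Fin (length ys)
    index x = Any.index (Enum.deduplicate⁺ DS enum x)
    at : ∀ x → x ≈ lookup ys (index x)
    at x = Anyₚ.lookup-index (Enum.deduplicate⁺ DS enum x)

functions : ∀ m n → Finite (Fin m →-setoid Fin n)
functions zero    n = (λ ()) ∷ [] , λ f → here λ ()
functions (suc m) n with functions m n
... | fs , enum = cartesianProductWith cons (allFin n) fs , λ f →
  Anyₚ.cartesianProductWith⁺ cons (≗-cons f) (Propₚ.∈-allFin (f zero)) (enum (f ∘ suc))
  where
  ≗-cons : ∀ (f : Fin (suc m) → Fin n) {x g} → f zero ≡ x → f ∘ suc ≗ g → f ≗ cons x g
  ≗-cons f p q zero    = p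
  ≗-cons f p q (suc i) = q i

permutationSetoid : ℕ → Setoid 0ℓ 0ℓ
permutationSetoid v = record
  { Carrier       = Permutation′ v
  ; _≈_           = Perm._≈_
  ; isEquivalence = record
    { refl  = λ _ → refl
    ; sym   = λ p i → sym (p i)
    ; trans = λ p q i → trans (p i) (q i)
    }
  }

permutations : ∀ v → Finite (permutationSetoid v)
permutations v = comprehension (F ×ₛ F) (permutationSetoid v)
  (_ , Enum.cartesianProduct⁺ F F (proj₂ (functions v v)) (proj₂ (functions v v)))
  (λ (f , g) → Fin.all? (λ i → f (g i) Fin.≟ i) ×-dec Fin.all? (λ i → g (f i) Fin.≟ i))
  (λ (f , g) (l , r) → permutation f g l r)
  (λ π → ((π ⟨$⟩ʳ_) , (π ⟨$⟩ˡ_)) , λ (f , g) (p , q) →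
    ( (λ i → trans (sym (p (g i))) (trans (cong (π ⟨$⟩ʳ_) (sym (q i))) (Perm.inverseʳ π)))
    , (λ i → trans (sym (q (f i))) (trans (cong (π ⟨$⟩ˡ_) (sym (p i))) (Perm.inverseˡ π))))
    , λ _ → p)
  where F = Fin v →-setoid Fin v

infix 4 _≈ᶜ?_ _∈?_
infix 3 _⇔?_

edge? : (B : Cycle v k) → ∀ x y → Dec (Edge B x y)
edge? B x y = map′
  (λ { (i , inj₁ (refl , refl)) → forward i ; (i , inj₂ (refl , refl)) → backward i })
  (λ { (forward i) → i , inj₁ (refl , refl) ; (backward i) → i , inj₂ (refl , refl) })
  (Fin.any? λ i → (vertex B i Fin.≟ x ×-dec vertex B (next i) Fin.≟ y)
              ⊎-dec (vertex B (next i) Fin.≟ x ×-dec vertex B i Fin.≟ y))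

_⇔?_ : {P Q : Set} → Dec P → Dec Q → Dec (P ⇔ Q)
P? ⇔? Q? = map′ (λ (f , g) → mk⇔ f g) (λ e → Equivalence.to e , Equivalence.from e)
  ((P? →-dec Q?) ×-dec (Q? →-dec P?))

_≈ᶜ?_ : (B C : Cycle v k) → Dec (B ≈ᶜ C)
B ≈ᶜ? C = map′ mk≈ᶜ edges (Fin.all? λ x → Fin.all? λ y → edge? B x y ⇔? edge? C x y)

_∈?_ : (B : Cycle v k) (Bs : List (Cycle v k)) → Dec (B ∈ Bs)
B ∈? Bs = Any.any? (B ≈ᶜ?_) Bs

allCycles : ∀ v k → Finite (cycleSetoid v k)
allCycles v k = comprehension (Fin k →-setoid Fin v) (cycleSetoid v k) (functions k v)
  (λ f → (3 ℕ.≤? k) ×-dec map′ (λ inj {i} {j} → inj i j) (λ inj i j → inj {i} {j})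
    (Fin.all? λ i → Fin.all? λ j → (f i Fin.≟ f j) →-dec (i Fin.≟ j)))
  (λ f (le , inj) → record { 3≤k = le ; vertex = f ; injective = inj })
  (λ B → vertex B , λ f p →
    (3≤k B , λ {i} {j} eq → injective B (trans (p i) (trans eq (sym (p j)))))
    , λ _ → ≗⇒≈ᶜ p)

isDesign? : Decidable (IsDesign {v} {k})
isDesign? Bs = map′
  (λ (c , d) → record
    { covered  = c
    ; disjoint = λ B C B∈ C∈ x y e f → let
        B′ , B′∈ , B≈B′ = Prop.find B∈
        C′ , C′∈ , C≈C′ = Prop.find C∈
        in ≈ᶜ-trans B≈B′ (≈ᶜ-trans
          (All.lookup (All.lookup d B′∈) C′∈ x y
            (Equivalence.to (edges B≈B′ x y) e) (Equivalence.to (edges C≈C′ x y) f))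
          (≈ᶜ-sym C≈C′))
    })
  (λ D → covered D , All.tabulate λ B∈ → All.tabulate λ C∈ →
    disjoint D _ _ (∈ₚ⇒∈ B∈) (∈ₚ⇒∈ C∈))
  ((Fin.all? λ x → Fin.all? λ y → ¬? (x Fin.≟ y) →-dec Any.any? (λ B → edge? B x y) Bs)
    ×-dec All.all? (λ B → All.all? (λ C → Fin.all? λ x → Fin.all? λ y →
      edge? B x y →-dec (edge? C x y →-dec (B ≈ᶜ? C))) Bs) Bs)
  where
  ∈ₚ⇒∈ : ∀ {B : Cycle _ _} {Bs} → B Prop.∈ Bs → B ∈ Bs
  ∈ₚ⇒∈ = Any.map λ { refl → ≈ᶜ-refl }

cycleSets : ℕ → ℕ → Setoid 0ℓ 0ℓ
cycleSets v k = record
  { Carrier       = List (Cycle v k)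
  ; _≈_           = λ Bs Cs → ∀ (B : Cycle v k) → B ∈ Bs ⇔ B ∈ Cs
  ; isEquivalence = record
    { refl  = λ _ → ⇔.refl
    ; sym   = λ p B → ⇔.sym (p B)
    ; trans = λ p q B → ⇔.trans (p B) (q B)
    }
  }
  where module ⇔ = IsEquivalence (⇔-isEquivalence {0ℓ})

private
  sublists : {A : Set a} → List A → List (List A)
  sublists []       = [] ∷ []
  sublists (x ∷ xs) = map (x ∷_) (sublists xs) ++ sublists xs

  filter-sublist : {A : Set a} {P : A → Set p} (P? : Decidable P) →
                   ∀ xs → filter P? xs Prop.∈ sublists xs
  filter-sublist P? []       = here refl
  filter-sublist P? (x ∷ xs) with P? x
  ... | yes _ = Propₚ.∈-++⁺ˡ (Propₚ.∈-map⁺ (x ∷_) (filter-sublist P? xs))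
  ... | no  _ = Propₚ.∈-++⁺ʳ (map (x ∷_) (sublists xs)) (filter-sublist P? xs)

allCycleSets : ∀ v k → Finite (cycleSets v k)
allCycleSets v k = sublists xs , λ Bs →
  Any.map (λ { refl B → mk⇔
      (Membershipₚ.∈-filter⁺ (cycleSetoid v k) (_∈? Bs) ∈-resp (proj₂ (allCycles v k) B))
      (proj₂ ∘ Membershipₚ.∈-filter⁻ (cycleSetoid v k) (_∈? Bs) ∈-resp {xs = xs}) })
    (filter-sublist (_∈? Bs) xs)
  where xs = proj₁ (allCycles v k)

IsDesign-resp : IsDesign {v} {k} Respects (Setoid._≈_ (cycleSets v k))
IsDesign-resp eq D = record
  { covered  = λ x y x≢y → let B , B∈ , e = Prop.find (covered D x y x≢y)
                               C , C∈ , B≈C = Prop.find (Equivalence.to (eq B) (Any.map (λ { refl → ≈ᶜ-refl }) B∈))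
                           in Prop.lose C∈ (Equivalence.to (edges B≈C x y) e)
  ; disjoint = λ B C B∈ C∈ → disjoint D B C (Equivalence.from (eq B) B∈) (Equivalence.from (eq C) C∈)
  }

designSets : ℕ → ℕ → Setoid 0ℓ 0ℓ
designSets v k = On.setoid (cycleSets v k) (cycles {v} {k})

allDesigns : ∀ v k → Finite (designSets v k)
allDesigns v k = comprehension (cycleSets v k) (designSets v k) (allCycleSets v k) isDesign? design
  (λ D → cycles D , λ Bs eq → IsDesign-resp eq (isDesign D) , λ _ → eq)

isCyclic? : Decidable (IsCyclic {v} {k})
isCyclic? {v} {k} D = ∃? (permutationSetoid v) (permutations v)
  (λ {φ} {ψ} φ≈ψ c z B B∈ →
    ∈-resp (·-congˡ {π = conj φ z} {conj ψ z} (conj-cong {φ} {ψ} φ≈ψ z) B) (c z B B∈))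
  (λ φ → Fin.all? λ z → ∀? (cycleSetoid v k) (allCycles v k)
    (λ B≈C f C∈ → ∈-resp (·-congʳ (conj φ z) B≈C) (f (∈-resp (≈ᶜ-sym B≈C) C∈)))
    (λ B → (B ∈? cycles D) →-dec (conj φ z · B ∈? cycles D)))
  where
  conj : Permutation′ v → Fin v → Permutation′ v
  conj φ z = φ ∘ₚ translation z ∘ₚ Perm.flip φ

  conj-cong : ∀ {φ ψ} → φ Perm.≈ ψ → ∀ z → conj φ z Perm.≈ conj ψ z
  conj-cong {φ} {ψ} eq z x = trans (cong (λ y → φ ⟨$⟩ˡ (translation z ⟨$⟩ʳ y)) (eq x))
    (flip-cong {π = φ} {ψ} eq _)

isomorphic? : (D E : Design v k) → Dec (Isomorphic D E)
isomorphic? {v} {k} D E = ∃? (permutationSetoid v) (permutations v)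
  (λ {π} {ρ} π≈ρ f B → mk⇔
    (∈-resp (·-congˡ {π = π} {ρ} π≈ρ B) ∘ Equivalence.to (f B))
    (Equivalence.from (f B) ∘ ∈-resp (·-congˡ {π = ρ} {π} (sym ∘ π≈ρ) B)))
  (λ π → ∀? (cycleSetoid v k) (allCycles v k)
    (λ B≈C f → mk⇔
      (∈-resp (·-congʳ π B≈C) ∘ Equivalence.to f ∘ ∈-resp (≈ᶜ-sym B≈C))
      (∈-resp B≈C ∘ Equivalence.from f ∘ ∈-resp (·-congʳ π (≈ᶜ-sym B≈C))))
    (λ B → (B ∈? cycles D) ⇔? (π · B ∈? cycles E)))

IsCyclic-resp : IsCyclic {v} {k} Respects (Setoid._≈_ (designSets v k))
IsCyclic-resp eq (φ , c) = φ , λ z B B∈ → Equivalence.to (eq _) (c z B (Equivalence.from (eq B) B∈))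

allCyclicDesigns : ∀ v k → Finite (cyclicDesignSetoid v k)
allCyclicDesigns v k = comprehension (designSets v k) (cyclicDesignSetoid v k) (allDesigns v k) isCyclic? _,_
  (λ (D , c) → D , λ E eq → IsCyclic-resp {x = D} {y = E} eq c , λ _ →
    Perm.id , λ B → mk⇔
      (∈-resp (≗⇒≈ᶜ λ _ → refl) ∘ Equivalence.to (eq B))
      (Equivalence.from (eq B) ∘ ∈-resp (≗⇒≈ᶜ λ _ → refl)))

abstract
  isomorphismClasses : ∀ v k → ∃ λ c → Inverse (cyclicDesignSetoid v k) (setoid (Fin c))
  isomorphismClasses v k = cardinality (cyclicDesignSetoid v k) (allCyclicDesigns v k)
    λ (D , _) (E , _) → isomorphic? D E

NC : ℕ → ℕ → ℕ
NC v k = proj₁ (isomorphismClasses v k)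

{-# OPTIONS --safe #-}
module Submission where

-- The two exponential bounds follow from a superexponential one: for v = 10n + 1 the signed differences
-- 1, …, 5n split into n zero-sum quintuples (mod v) so that about n/2 of these have the form
-- (s, -x, x + G, p, q) with the same gap G.  The pairs x, x + G may then be permuted freely among
-- these quintuples, so with m ~ n/2 there are m! distinct cyclic designs on ℤ/v.
-- Few of them are isomorphic: one cycle has the consecutive differences 1, -2, so that an isomorphism
-- is known at a - 1 once it is known at a and a + 1, hence is determined by two of its values.
-- Therefore m! ≤ NC · v², which exceeds 39ⁿ · v² for large n.

open import Defs
open import Data.Fin.Base using (Fin; zero; suc; toℕ; fromℕ<; combine; opposite; punchIn; punchOut; remQuot)
open import Data.Fin.Patterns
open import Data.Fin.Permutation as Perm using (Permutation′; _⟨$⟩ʳ_; _⟨$⟩ˡ_)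
import Data.Fin.Properties as Fin
open import Data.Integer.Base as ℤ using (ℤ; +_; -_; ∣_∣; 0ℤ; 1ℤ)
import Data.Integer.DivMod as ℤ÷
import Data.Integer.Properties as ℤₚ
open import Data.Integer.Tactic.RingSolver using (solve-∀)
open import Data.List.Base using (List; []; _∷_; allFin; cartesianProductWith; length; lookup)
import Data.List.Membership.Propositional as Prop
import Data.List.Membership.Propositional.Properties as Propₚ
open import Data.List.Relation.Unary.Any as Any using (Any)
open import Data.Nat.Base as ℕ using (ℕ; _!)
import Data.Nat.Coprimality as Coprime
open import Data.Nat.DivMod using (_%_)
open import Data.Nat.ListAction using (sum)
import Data.Nat.Properties as ℕₚ
open import Data.Nat.Tactic.RingSolver using () renaming (solve-∀ to ℕ-solve-∀)
open import Data.Product.Base using (∃; ∃₂; _×_; _,_; proj₁; proj₂)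
open import Data.Rational.Base as ℚ using (_/_; +-*-rawSemiring)
import Data.Rational.Properties as ℚₚ
open import Data.Sum.Base using (_⊎_; inj₁; inj₂; [_,_]′)
open import Data.Sum.Function.Propositional using (_⊎-↔_)
open import Algebra.Definitions.RawSemiring +-*-rawSemiring using (_^_)
open import Function.Base using (_∘_)
open import Function.Bundles using (Equivalence; Injection; Inverse; _↔_)
open import Function.Definitions using (Injective)
open import Function.Properties.Inverse using (↔⇒↣; ↔-refl; ↔-sym; ↔-trans)
open import Relation.Binary.PropositionalEquality
  using (_≡_; _≢_; refl; sym; trans; cong; cong₂; subst; subst₂; module ≡-Reasoning)
open import Relation.Binary.Structures using (IsEquivalence)
open import Relation.Nullary.Decidable using (yes; no; from-yes; _→-dec_; _⊎-dec_; ¬?)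
open import Relation.Nullary.Negation using (¬_; contradiction)

-- Integers modulo `v` and their residues in `Fin v`.

module Residues (v : ℕ) .{{_ : ℕ.NonZero v}} where
  open import Data.Integer.Base using (_+_; _-_; _*_)

  infix 4 _≋_
  -- Keeping the quotient as data turns each closure property below into an integer ring identity
  -- with an explicit new quotient.
  record _≋_ (a b : ℤ) : Set where
    constructor _by_
    field
      quotient : ℤ
      equality : a ≡ b + quotient * + v

  ≋-reflexive : ∀ {a b} → a ≡ b → a ≋ b
  ≋-reflexive {a} refl = 0ℤ by solve a (+ v)
    where
    solve : ∀ a w → a ≡ a + 0ℤ * w
    solve = solve-∀

  ≋-refl : ∀ {a} → a ≋ a
  ≋-refl = ≋-reflexive refl

  ≋-sym : ∀ {a b} → a ≋ b → b ≋ a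
  ≋-sym {b = b} (q by refl) = (- q) by solve b q (+ v)
    where
    solve : ∀ b q w → b ≡ b + q * w + - q * w
    solve = solve-∀

  ≋-trans : ∀ {a b c} → a ≋ b → b ≋ c → a ≋ c
  ≋-trans {c = c} (q by refl) (r by refl) = (r + q) by solve c q r (+ v)
    where
    solve : ∀ c q r w → c + r * w + q * w ≡ c + (r + q) * w
    solve = solve-∀

  +-≋ : ∀ {a b c d} → a ≋ b → c ≋ d → a + c ≋ b + d
  +-≋ {b = b} {d = d} (q by refl) (r by refl) = (q + r) by solve b d q r (+ v)
    where
    solve : ∀ b d q r w → b + q * w + (d + r * w) ≡ b + d + (q + r) * w
    solve = solve-∀

  neg-≋ : ∀ {a b} → a ≋ b → - a ≋ - b
  neg-≋ {b = b} (q by refl) = (- q) by solve b q (+ v)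
    where
    solve : ∀ b q w → - (b + q * w) ≡ - b + - q * w
    solve = solve-∀

  ≋-resp : ∀ {a b c d} → a ≡ c → b ≡ d → a ≋ b → c ≋ d
  ≋-resp refl refl p = p

  +-≋ʳ : ∀ {a b} c → a ≋ b → a + c ≋ b + c
  +-≋ʳ c p = +-≋ p ≋-refl

  ≋-cancelˡ : ∀ {a b} c → c + a ≋ c + b → a ≋ b
  ≋-cancelˡ {a} {b} c eq = ≋-resp (solve c a) (solve c b) (+-≋ (≋-refl { - c}) eq)
    where
    solve : ∀ c a → - c + (c + a) ≡ a
    solve = solve-∀

  ≋0⇒≡0 : ∀ {a} → ∣ a ∣ ℕ.< v → a ≋ 0ℤ → a ≡ 0ℤ
  ≋0⇒≡0 {a} small (q by eq) = ℤₚ.∣i∣≡0⇒i≡0 (trans ∣a∣ (cong (ℕ._* v) (q≡0 ∣ q ∣ (subst (ℕ._< v) ∣a∣ small))))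
    where
    ∣a∣ : ∣ a ∣ ≡ ∣ q ∣ ℕ.* v
    ∣a∣ = trans (cong ∣_∣ (trans eq (ℤₚ.+-identityˡ (q * + v)))) (ℤₚ.abs-* q (+ v))
    q≡0 : ∀ t → t ℕ.* v ℕ.< v → t ≡ 0
    q≡0 ℕ.zero    _ = refl
    q≡0 (ℕ.suc t) p = contradiction p (ℕₚ.≤⇒≯ (ℕₚ.m≤m+n v (t ℕ.* v)))

  ≋⇒≡ : ∀ {a b} → ∣ a - b ∣ ℕ.< v → a ≋ b → a ≡ b
  ≋⇒≡ {a} {b} small a≋b = ℤₚ.i-j≡0⇒i≡j a b
    (≋0⇒≡0 small (≋-resp refl (ℤₚ.+-inverseʳ b) (+-≋ʳ (- b) a≋b)))

  ι : Fin v → ℤ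
  ι x = + toℕ x

  abstract
    ⟦_⟧ : ℤ → Fin v
    ⟦ a ⟧ = fromℕ< (ℤ÷.n%ℕd<d a v)

    ι⟦_⟧ : ∀ a → ι ⟦ a ⟧ ≋ a
    ι⟦ a ⟧ = ≋-sym ((a ℤ./ℕ v) by trans (ℤ÷.a≡a%ℕn+[a/ℕn]*n a v)
      (cong (λ r → + r + (a ℤ./ℕ v) * + v) (sym (Fin.toℕ-fromℕ< (ℤ÷.n%ℕd<d a v)))))

    -- Placed inside the `abstract` block because `refl` proves it only while `⟦_⟧` unfolds.
    translation-⟦⟧ : ∀ z x → translation z ⟨$⟩ʳ x ≡ ⟦ ι x + ι z ⟧
    translation-⟦⟧ z x = refl

  ι-injective : ∀ {x y} → ι x ≋ ι y → x ≡ y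
  ι-injective {x} {y} p = Fin.toℕ-injective (ℤₚ.+-injective (≋⇒≡ (∣ιx-ιy∣<v) p))
    where
    ∣ιx-ιy∣<v : ∣ ι x - ι y ∣ ℕ.< v
    ∣ιx-ιy∣<v = subst (ℕ._< v) (cong ∣_∣ (sym (ℤₚ.m-n≡m⊖n (toℕ x) (toℕ y))))
      (ℕₚ.≤-<-trans (ℤₚ.∣m⊝n∣≤m⊔n (toℕ x) (toℕ y)) (ℕₚ.⊔-lub (Fin.toℕ<n x) (Fin.toℕ<n y)))

  ⟦⟧-cong : ∀ {a b} → a ≋ b → ⟦ a ⟧ ≡ ⟦ b ⟧
  ⟦⟧-cong {a} {b} p = ι-injective (≋-trans ι⟦ a ⟧ (≋-trans p (≋-sym ι⟦ b ⟧)))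

  ⟦⟧-injective : ∀ {a b} → ⟦ a ⟧ ≡ ⟦ b ⟧ → a ≋ b
  ⟦⟧-injective {a} {b} p = ≋-trans (≋-sym ι⟦ a ⟧) (≋-trans (≋-reflexive (cong ι p)) ι⟦ b ⟧)

  ⟦ι_⟧ : ∀ x → ⟦ ι x ⟧ ≡ x
  ⟦ι x ⟧ = ι-injective ι⟦ ι x ⟧

-- Paths of two edges in pentagon systems.

next-injective : ∀ (p q : Fin 5) → next p ≡ next q → p ≡ q
next-injective = from-yes (Fin.all? λ (p : Fin 5) → Fin.all? λ q → (next p Fin.≟ next q) →-dec (p Fin.≟ q))

next²-≢ : ∀ (p : Fin 5) → p ≢ next (next p)
next²-≢ = from-yes (Fin.all? λ (p : Fin 5) → ¬? (p Fin.≟ next (next p)))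

-- Any two vertices of a pentagon are one or two steps apart, so distinctness of five points needs
-- checking only for neighbours and second neighbours.
next-next² : ∀ (p q : Fin 5) → p ≢ q →
  (q ≡ next p ⊎ q ≡ next (next p)) ⊎ (p ≡ next q ⊎ p ≡ next (next q))
next-next² = from-yes (Fin.all? λ (p : Fin 5) → Fin.all? λ q → ¬? (p Fin.≟ q) →-dec
  (((q Fin.≟ next p) ⊎-dec (q Fin.≟ next (next p))) ⊎-dec ((p Fin.≟ next q) ⊎-dec (p Fin.≟ next (next q)))))

private
  variable
    v : ℕ

edge-ends : ∀ {B : Cycle v 5} {x y} → Edge B x y →
  ∃ λ p → (vertex B p ≡ x × vertex B (next p) ≡ y) ⊎ (vertex B p ≡ y × vertex B (next p) ≡ x)
edge-ends (forward p)  = p , inj₁ (refl , refl)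
edge-ends (backward p) = p , inj₂ (refl , refl)

-- Membership is up to `_≈ᶜ_`, so a cycle may be read from any starting point and in either
-- direction.
record Path (D : Design v 5) (x y z : Fin v) : Set where
  field
    cycle    : Cycle v 5
    member   : cycle ∈ cycles D
    position : Fin 5
    first    : vertex cycle position ≡ x
    second   : vertex cycle (next position) ≡ y
    third    : vertex cycle (next (next position)) ≡ z

-- The second edge on the `B` side is also an edge of `C` at the common middle vertex. If it ran
-- backwards along `C`, it would return to the first vertex, which differs from the third one in
-- `B`.
third-unique : ∀ {B C : Cycle v 5} p q → B ≈ᶜ C →
  vertex B p ≡ vertex C q → vertex B (next p) ≡ vertex C (next q) →
  vertex B (next (next p)) ≡ vertex C (next (next q))
third-unique {B = B} {C} p q B≈C first second
  with edge-ends (Equivalence.to (edges B≈C _ _) (forward (next p)))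
... | r , inj₁ (Cr≡ , Cr′≡) with refl ← injective C (trans Cr≡ second) = sym Cr′≡
... | r , inj₂ (Cr≡ , Cr′≡) with refl ← next-injective r q (injective C (trans Cr′≡ second)) =
  contradiction (injective B (trans first Cr≡)) (next²-≢ p)

-- By `disjoint` only one cycle contains the first edge, and that cycle has one continuation beyond
-- it.
path-unique : ∀ {D : Design v 5} {x y z w} → Path D x y z → Path D x y w → z ≡ w
path-unique {D = D} P Q = trans (sym P.third) (trans
  (third-unique P.position Q.position P≈Q (trans P.first (sym Q.first)) (trans P.second (sym Q.second)))
  Q.third)
  where
  module P = Path P
  module Q = Path Q
  edge : ∀ {x y z} (R : Path D x y z) → Edge (Path.cycle R) x y
  edge record { position = r ; first = refl ; second = refl } = forward r
  P≈Q : P.cycle ≈ᶜ Q.cycle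
  P≈Q = disjoint (isDesign D) _ _ P.member Q.member _ _ (edge P) (edge Q)

path-image : ∀ {D E : Design v 5} {x y z} ((π , _) : Isomorphic D E) →
  Path D x y z → Path E (π ⟨$⟩ʳ x) (π ⟨$⟩ʳ y) (π ⟨$⟩ʳ z)
path-image (π , D⇔E) P = record
  { cycle    = π · P.cycle
  ; member   = Equivalence.to (D⇔E P.cycle) P.member
  ; position = P.position
  ; first    = cong (π ⟨$⟩ʳ_) P.first
  ; second   = cong (π ⟨$⟩ʳ_) P.second
  ; third    = cong (π ⟨$⟩ʳ_) P.third
  }
  where module P = Path P

infix 4 _⊆ᵈ_
_⊆ᵈ_ : Design v 5 → Design v 5 → Set
D ⊆ᵈ E = ∀ B → B ∈ cycles D → B ∈ cycles E

path-mono : ∀ {D E : Design v 5} → D ⊆ᵈ E → ∀ {x y z} → Path D x y z → Path E x y z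
path-mono D⊆E P = record { Path P ; member = D⊆E _ (Path.member P) }

-- Rigidity of designs with consecutive differences 1, -2.

module Rigidity (v : ℕ) .{{_ : ℕ.NonZero v}} where
  open Residues v
  open import Data.Integer.Base using (_+_; _-_)

  Zigzag : Design v 5 → Set
  Zigzag D = ∀ a → Path D ⟦ a ⟧ ⟦ a + 1ℤ ⟧ ⟦ a - 1ℤ ⟧

  -- The path a, a + 1, a - 1 lies in both `D` and `E`. Once the two maps agree at a and a + 1, its
  -- images are two paths of `R` with the same first edge, so `path-unique` gives agreement at a -
  -- 1. Descending from 0 reaches every residue.
  rigid : ∀ {D E R : Design v 5} → Zigzag D → Zigzag E →
    ((π , _) : Isomorphic D R) ((ρ , _) : Isomorphic E R) →
    π ⟨$⟩ʳ ⟦ 0ℤ ⟧ ≡ ρ ⟨$⟩ʳ ⟦ 0ℤ ⟧ → π ⟨$⟩ʳ ⟦ 1ℤ ⟧ ≡ ρ ⟨$⟩ʳ ⟦ 1ℤ ⟧ → π Perm.≈ ρ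
  rigid {D} {E} {R} zigD zigE I@(π , _) J@(ρ , _) at0 at1 x =
    subst Agree x≡ (proj₁ (descend (toℕ ⟦ - ι x ⟧)))
    where
    Agree : Fin v → Set
    Agree y = π ⟨$⟩ʳ y ≡ ρ ⟨$⟩ʳ y

    -- Two adjacent values are carried along, since the next one down depends on both.
    descend : ∀ k → Agree ⟦ - + k ⟧ × Agree ⟦ - + k + 1ℤ ⟧
    descend ℕ.zero    = at0 , at1
    descend (ℕ.suc k) with descend k
    ... | here , there =
        subst Agree (cong ⟦_⟧ (solve₁ (+ k))) (path-unique {D = R}
          (path-image {D = D} {R} I (zigD (- + k)))
          (subst₂ (λ y z → Path R y z _) (sym here) (sym there) (path-image {D = E} {R} J (zigE (- + k)))))
      , subst Agree (cong ⟦_⟧ (solve₂ (+ k))) here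
      where
      solve₁ : ∀ k → - k - 1ℤ ≡ - (1ℤ + k)
      solve₁ = solve-∀
      solve₂ : ∀ k → - k ≡ - (1ℤ + k) + 1ℤ
      solve₂ = solve-∀

    x≡ : ⟦ - + toℕ ⟦ - ι x ⟧ ⟧ ≡ x
    x≡ = trans (⟦⟧-cong (≋-resp refl (ℤₚ.neg-involutive (ι x)) (neg-≋ ι⟦ - ι x ⟧))) ⟦ι x ⟧

-- Difference families.

total : (Fin 5 → ℤ) → ℤ
total d = d 0F ℤ.+ (d 1F ℤ.+ (d 2F ℤ.+ (d 3F ℤ.+ d 4F)))

∣∣-cases : ∀ {d k} → ∣ d ∣ ≡ k → + k ≡ d ⊎ + k ≡ - d
∣∣-cases {+ _}         refl = inj₁ refl
∣∣-cases {ℤ.-[1+ _ ]}  refl = inj₂ refl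

-- difference b lists the signed edge differences of a base cycle in cyclic order; its cycle has five distinct
-- vertices automatically, because no two of the differences are equal or opposite.
record DifferenceFamily (n : ℕ) : Set₁ where
  field
    Block      : Set
    index      : Block ↔ Fin n
    difference : Block → Fin 5 → ℤ
    closed     : ∀ b → ∃ λ q → total (difference b) ≡ q ℤ.* + (10 ℕ.* n ℕ.+ 1)
    covers     : ∀ (k : Fin (5 ℕ.* n)) → ∃₂ λ b p → ∣ difference b p ∣ ≡ ℕ.suc (toℕ k)

-- A missed value could be punched out, leaving an injection into a smaller `Fin`.
injective⇒surjective : ∀ {n} (f : Fin n → Fin n) → Injective _≡_ _≡_ f → ∀ y → ∃ λ x → f x ≡ y
injective⇒surjective {ℕ.suc n} f inj y with Fin.any? (λ x → f x Fin.≟ y)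
... | yes found  = found
... | no missing = contradiction
  (Fin.injective⇒≤ {f = λ x → punchOut {i = y} {f x} (missing ∘ (x ,_) ∘ sym)}
    (inj ∘ Fin.punchOut-injective {i = y} _ _))
  ℕₚ.1+n≰n

-- The cyclic design developed from a difference family.

module Development {n : ℕ} (F : DifferenceFamily n) where
  open import Data.Integer.Base using (_+_; _-_; _*_)
  open DifferenceFamily F
  module index = Inverse index

  modulus : ℕ
  modulus = 10 ℕ.* n ℕ.+ 1

  instance
    modulus≢0 : ℕ.NonZero modulus
    modulus≢0 = ℕ.≢-nonZero (ℕₚ.m+1+n≢0 (10 ℕ.* n))

  open Residues modulus

  -- There are as many slots (b , p) as absolute values 1, …, 5n, so covers already forces each value to occur once.
  slot : Fin (5 ℕ.* n) → Fin (5 ℕ.* n)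
  slot k = let b , p , _ = covers k in combine p (index.to b)

  slot-∣difference∣ : ∀ k b p → slot k ≡ combine p (index.to b) → ∣ difference b p ∣ ≡ ℕ.suc (toℕ k)
  slot-∣difference∣ k b p eq with covers k
  ... | b′ , p′ , ∣d∣ with refl , same ← Fin.combine-injective p′ (index.to b′) p (index.to b) eq
    with refl ← Injection.injective (↔⇒↣ index) same = ∣d∣

  -- The absolute value found in a slot recovers `k`, so `slot` is injective on a finite set and
  -- hence onto.
  slot-surjective : ∀ y → ∃ λ k → slot k ≡ y
  slot-surjective = injective⇒surjective slot λ {k} {l} eq →
    let b , p , ∣d∣ = covers l in
    Fin.toℕ-injective (ℕₚ.suc-injective (trans (sym (slot-∣difference∣ k b p eq)) ∣d∣))

  ∣difference∣ : ∀ b p → ∃ λ k → slot k ≡ combine p (index.to b) × ∣ difference b p ∣ ≡ ℕ.suc (toℕ k)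
  ∣difference∣ b p = let k , eq = slot-surjective (combine p (index.to b)) in
    k , eq , slot-∣difference∣ k b p eq

  ∣difference∣≤5n : ∀ b p → ∣ difference b p ∣ ℕ.≤ 5 ℕ.* n
  ∣difference∣≤5n b p with k , _ , eq ← ∣difference∣ b p rewrite eq = Fin.toℕ<n k

  ∣difference∣-injective : ∀ b p c q → ∣ difference b p ∣ ≡ ∣ difference c q ∣ → b ≡ c × p ≡ q
  ∣difference∣-injective b p c q same
    with k , slotk , eqk ← ∣difference∣ b p | l , slotl , eql ← ∣difference∣ c q
    with refl ← Fin.toℕ-injective (ℕₚ.suc-injective (trans (sym eqk) (trans same eql)))
    with refl , same′ ← Fin.combine-injective p (index.to b) q (index.to c) (trans (sym slotk) slotl)
    with refl ← Injection.injective (↔⇒↣ index) same′ = refl , refl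

  difference≢0 : ∀ b p → ¬ difference b p ≡ 0ℤ
  difference≢0 b p d≡0 with k , _ , eq ← ∣difference∣ b p with () ← trans (sym (cong ∣_∣ d≡0)) eq

  small-sum : ∀ {a b} → ∣ a ∣ ℕ.≤ 5 ℕ.* n → ∣ b ∣ ℕ.≤ 5 ℕ.* n → ∣ a - b ∣ ℕ.< modulus
  small-sum {a} {b} ∣a∣≤ ∣b∣≤ = begin-strict
    ∣ a - b ∣              ≤⟨ ℤₚ.∣i-j∣≤∣i∣+∣j∣ a b ⟩
    ∣ a ∣ ℕ.+ ∣ b ∣        ≤⟨ ℕₚ.+-mono-≤ ∣a∣≤ ∣b∣≤ ⟩
    5 ℕ.* n ℕ.+ 5 ℕ.* n    ≡⟨ ℕₚ.*-distribʳ-+ n 5 5 ⟨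
    10 ℕ.* n               <⟨ ℕₚ.m<m+n (10 ℕ.* n) ℕ.z<s ⟩
    modulus                ∎
    where open ℕₚ.≤-Reasoning

  -- Since 5n + 5n < 10n + 1, congruences between signed differences can be read as equations.
  small-≋ : ∀ {a b} → ∣ a ∣ ℕ.≤ 5 ℕ.* n → ∣ b ∣ ℕ.≤ 5 ℕ.* n → a ≋ b → a ≡ b
  small-≋ {a} {b} ∣a∣≤ ∣b∣≤ = ≋⇒≡ (small-sum {a} {b} ∣a∣≤ ∣b∣≤)

  ∣neg-difference∣≤5n : ∀ b p → ∣ - difference b p ∣ ℕ.≤ 5 ℕ.* n
  ∣neg-difference∣≤5n b p = subst (ℕ._≤ 5 ℕ.* n) (sym (ℤₚ.∣-i∣≡∣i∣ (difference b p))) (∣difference∣≤5n b p)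

  difference-≋-injective : ∀ b p c q → difference b p ≋ difference c q → b ≡ c × p ≡ q
  difference-≋-injective b p c q eq = ∣difference∣-injective b p c q
    (cong ∣_∣ (small-≋ (∣difference∣≤5n b p) (∣difference∣≤5n c q) eq))

  -- By smallness the congruence would be an equation, so both differences would have the same
  -- absolute value and occupy the same slot. A number equal to its own negative is 0, yet the
  -- absolute values start at 1.
  difference-≋-neg : ∀ b p c q → ¬ difference b p ≋ - difference c q
  difference-≋-neg b p c q eq = same-slot
    (∣difference∣-injective b p c q (trans (cong ∣_∣ d≡-d) (ℤₚ.∣-i∣≡∣i∣ (difference c q)))) d≡-d
    where
    d≡-d : difference b p ≡ - difference c q
    d≡-d = small-≋ (∣difference∣≤5n b p) (∣neg-difference∣≤5n c q) eq
    self-opposite : ∀ a → a ≡ - a → a ≡ 0ℤ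
    self-opposite (+ ℕ.zero)  _ = refl
    same-slot : ∀ {b p c q} → b ≡ c × p ≡ q → ¬ difference b p ≡ - difference c q
    same-slot {b} {p} (refl , refl) eq = difference≢0 b p (self-opposite (difference b p) eq)

  difference≋̸0 : ∀ b p → ¬ difference b p ≋ 0ℤ
  difference≋̸0 b p eq = difference≢0 b p (small-≋ (∣difference∣≤5n b p) ℕ.z≤n eq)

  offset : Block → Fin 5 → ℤ
  offset b 0F = 0ℤ
  offset b 1F = difference b 0F
  offset b 2F = difference b 0F + difference b 1F
  offset b 3F = difference b 0F + difference b 1F + difference b 2F
  offset b 4F = difference b 0F + difference b 1F + difference b 2F + difference b 3F

  offset-next : ∀ b p → offset b (next p) ≋ offset b p + difference b p
  offset-next b 0F = ≋-reflexive (sym (ℤₚ.+-identityˡ (difference b 0F)))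
  offset-next b 1F = ≋-refl
  offset-next b 2F = ≋-refl
  offset-next b 3F = ≋-refl
  -- The wrap-around from the last vertex to the first is the one place where the block has to close
  -- up modulo `modulus`.
  offset-next b 4F with q , eq ← closed b = ≋-sym (q by trans
    (solve (difference b 0F) (difference b 1F) (difference b 2F) (difference b 3F) (difference b 4F))
    (trans eq (sym (ℤₚ.+-identityˡ (q * + modulus)))))
    where
    solve : ∀ d₀ d₁ d₂ d₃ d₄ → d₀ + d₁ + d₂ + d₃ + d₄ ≡ d₀ + (d₁ + (d₂ + (d₃ + d₄)))
    solve = solve-∀

  point : Block → Fin modulus → Fin 5 → Fin modulus
  point b z p = ⟦ offset b p + ι z ⟧

  point-next : ∀ b z p → ι (point b z (next p)) ≋ ι (point b z p) + difference b p
  point-next b z p = ≋-trans ι⟦ _ ⟧ (≋-trans (+-≋ʳ (ι z) (offset-next b p)) (≋-sym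
    (≋-resp refl (solve (offset b p) (difference b p) (ι z)) (+-≋ʳ (difference b p) ι⟦ offset b p + ι z ⟧))))
    where
    solve : ∀ o d z → o + z + d ≡ o + d + z
    solve = solve-∀

  point-next-≢ : ∀ b z p → point b z p ≢ point b z (next p)
  point-next-≢ b z p eq = difference≋̸0 b p (≋-sym (≋-cancelˡ (ι (point b z p))
    (≋-trans (≋-reflexive (trans (ℤₚ.+-identityʳ _) (cong ι eq))) (point-next b z p))))

  -- A coincidence two steps apart would make two consecutive differences opposite.
  point-next²-≢ : ∀ b z p → point b z p ≢ point b z (next (next p))
  point-next²-≢ b z p eq = difference-≋-neg b p b (next p) d≋-d′
    where
    d  = difference b p
    d′ = difference b (next p)
    step : ι (point b z p) + (d + d′) ≋ ι (point b z p) + 0ℤ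
    step = ≋-sym (≋-trans (≋-reflexive (trans (ℤₚ.+-identityʳ _) (cong ι eq)))
      (≋-trans (point-next b z (next p)) (≋-trans (+-≋ʳ d′ (point-next b z p))
        (≋-reflexive (ℤₚ.+-assoc (ι (point b z p)) d d′)))))
    d≋-d′ : d ≋ - d′
    d≋-d′ = ≋-resp (solve d d′) (ℤₚ.+-identityˡ (- d′)) (+-≋ʳ {d + d′} {0ℤ} (- d′) (≋-cancelˡ (ι (point b z p)) step))
      where
      solve : ∀ d d′ → d + d′ + - d′ ≡ d
      solve = solve-∀

  point-injective : ∀ b z → Injective _≡_ _≡_ (point b z)
  point-injective b z {p} {q} eq with p Fin.≟ q
  ... | yes p≡q = p≡q
  ... | no  p≢q with next-next² p q p≢q
  ...   | inj₁ (inj₁ refl) = contradiction eq (point-next-≢ b z p)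
  ...   | inj₁ (inj₂ refl) = contradiction eq (point-next²-≢ b z p)
  ...   | inj₂ (inj₁ refl) = contradiction (sym eq) (point-next-≢ b z q)
  ...   | inj₂ (inj₂ refl) = contradiction (sym eq) (point-next²-≢ b z q)

  translate : Block → Fin modulus → Cycle modulus 5
  translate b z = record
    { 3≤k       = ℕ.s≤s (ℕ.s≤s (ℕ.s≤s ℕ.z≤n))
    ; vertex    = point b z
    ; injective = point-injective b z
    }

  translates : List (Cycle modulus 5)
  translates = cartesianProductWith (translate ∘ index.from) (allFin n) (allFin modulus)

  translate∈ : ∀ b z → translate b z Prop.∈ translates
  translate∈ b z = subst (λ c → translate c z Prop.∈ translates) (index.strictlyInverseʳ b)
    (Propₚ.∈-cartesianProductWith⁺ (translate ∘ index.from) (Propₚ.∈-allFin (index.to b)) (Propₚ.∈-allFin z))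

  ∈-translates : ∀ {B} → B ∈ translates → ∃₂ λ b z → B ≈ᶜ translate b z
  ∈-translates B∈ with C , C∈ , B≈C ← Prop.find B∈
    with _ , z , _ , _ , refl ← Propₚ.∈-cartesianProductWith⁻ (translate ∘ index.from) (allFin n) (allFin modulus) C∈
    = _ , z , B≈C

  ≈⇒∈ : ∀ {B} b z → B ≈ᶜ translate b z → B ∈ translates
  ≈⇒∈ b z B≈ = Any.map (λ { refl → B≈ }) (translate∈ b z)

  anchored : ∀ b p x → ∃ λ z → point b z p ≡ x
  anchored b p x = ⟦ ι x - offset b p ⟧ , ι-injective (≋-trans ι⟦ _ ⟧
    (≋-resp refl (solve (offset b p) (ι x)) (+-≋ (≋-refl {offset b p}) ι⟦ _ ⟧)))
    where
    solve : ∀ o x → o + (x - o) ≡ x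
    solve = solve-∀

  second-point : ∀ b z p {x y} → point b z p ≡ x → ι y ≋ ι x + difference b p → point b z (next p) ≡ y
  second-point b z p refl eq = ι-injective (≋-trans (point-next b z p) (≋-sym eq))

  -- The nonzero residues 1, ..., 10n fold onto 1, ..., 5n: the lower half stays, the upper half is
  -- subtracted from the modulus and negated.
  residue-abs : ∀ {a} → ¬ a ≋ 0ℤ → ∃ λ (k : Fin (5 ℕ.* n)) → a ≋ + ℕ.suc (toℕ k) ⊎ a ≋ - + ℕ.suc (toℕ k)
  residue-abs {a} a≋̸0 with toℕ ⟦ a ⟧ in eq
  ... | ℕ.zero  = contradiction (≋-trans (≋-sym ι⟦ a ⟧) (≋-reflexive (cong +_ eq))) a≋̸0
  ... | ℕ.suc r with r ℕₚ.<? 5 ℕ.* n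
  ...   | yes r<5n = fromℕ< r<5n , inj₁ (≋-trans (≋-sym ι⟦ a ⟧)
            (≋-reflexive (cong +_ (trans eq (cong ℕ.suc (sym (Fin.toℕ-fromℕ< r<5n)))))))
  ...   | no  r≮5n = fromℕ< s<5n , inj₂ (≋-trans (≋-sym ι⟦ a ⟧) (≋-trans (≋-reflexive (cong +_ eq))
            (1ℤ by trans (complement (+ ℕ.suc r) (+ ℕ.suc s) (+ modulus) (cong +_ r+s))
              (cong (λ t → - + ℕ.suc t + 1ℤ * + modulus) (sym (Fin.toℕ-fromℕ< s<5n))))))
    where
    open ℕₚ.≤-Reasoning
    s : ℕ
    -- Here `suc s` is the complement 10n + 1 - `suc r`; the index is one less than the absolute
    -- value.
    s = 10 ℕ.* n ℕ.∸ ℕ.suc r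
    r<10n : r ℕ.< 10 ℕ.* n
    r<10n = ℕ.s<s⁻¹ (subst₂ ℕ._<_ eq (ℕₚ.+-comm (10 ℕ.* n) 1) (Fin.toℕ<n ⟦ a ⟧))
    r+s : ℕ.suc r ℕ.+ ℕ.suc s ≡ modulus
    r+s = trans (ℕₚ.+-suc (ℕ.suc r) s) (trans (cong ℕ.suc (ℕₚ.m+[n∸m]≡n r<10n)) (ℕₚ.+-comm 1 (10 ℕ.* n)))
    s<5n : s ℕ.< 5 ℕ.* n
    s<5n = ℕₚ.+-cancelˡ-< (ℕ.suc r) s (5 ℕ.* n) (begin-strict
      ℕ.suc r ℕ.+ s          ≡⟨ ℕₚ.m+[n∸m]≡n r<10n ⟩
      10 ℕ.* n               ≡⟨ ℕₚ.*-distribʳ-+ n 5 5 ⟩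
      5 ℕ.* n ℕ.+ 5 ℕ.* n    ≤⟨ ℕₚ.+-monoˡ-≤ (5 ℕ.* n) (ℕₚ.≮⇒≥ r≮5n) ⟩
      r ℕ.+ 5 ℕ.* n          <⟨ ℕₚ.n<1+n _ ⟩
      ℕ.suc r ℕ.+ 5 ℕ.* n    ∎)
    complement : ∀ x y w → x + y ≡ w → x ≡ - y + 1ℤ * w
    complement x y w refl = solve x y
      where
      solve : ∀ x y → x ≡ - y + 1ℤ * (x + y)
      solve = solve-∀

  represented : ∀ {a} → ¬ a ≋ 0ℤ → ∃₂ λ b p → a ≋ difference b p ⊎ a ≋ - difference b p
  represented {a} a≋̸0 with k , a≋±k ← residue-abs a≋̸0 with b , p , ∣d∣ ← covers k = b , p , combined a≋±k (∣∣-cases ∣d∣)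
    where
    combined : ∀ {k d} → a ≋ k ⊎ a ≋ - k → k ≡ d ⊎ k ≡ - d → a ≋ d ⊎ a ≋ - d
    combined (inj₁ e) (inj₁ refl) = inj₁ e
    combined (inj₁ e) (inj₂ refl) = inj₂ e
    combined (inj₂ e) (inj₁ refl) = inj₂ e
    combined {d = d} (inj₂ e) (inj₂ refl) = inj₁ (≋-trans e (≋-reflexive (ℤₚ.neg-involutive d)))

  -- An edge of a translate together with the direction in which its base block runs through it; the
  -- direction fixes the sign of the difference.
  record Arc (b : Block) (z : Fin modulus) (x y : Fin modulus) : Set where
    constructor arc
    field
      place : Fin 5
      start : point b z place ≡ x
      step  : ι y ≋ ι x + difference b place

  arcs : ∀ {b z x y} → Edge (translate b z) x y → Arc b z x y ⊎ Arc b z y x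
  arcs {b} {z} (forward p)  = inj₁ (arc p refl (point-next b z p))
  arcs {b} {z} (backward p) = inj₂ (arc p refl (point-next b z p))

  arc-edge : ∀ {b z x y} → Arc b z x y → Edge (translate b z) x y × Edge (translate b z) y x
  arc-edge {b} {z} {x} {y} (arc p start step) = subst₂ (Edge (translate b z)) start end (forward p)
                                              , subst₂ (Edge (translate b z)) end start (backward p)
    where
    end : point b z (next p) ≡ y
    end = second-point b z p start step

  point-translation-injective : ∀ b p {z w} → point b z p ≡ point b w p → z ≡ w
  point-translation-injective b p eq = ι-injective (≋-cancelˡ (offset b p) (⟦⟧-injective eq))

  -- The difference of the endpoints determines the slot, and the starting vertex then determines
  -- the translate.
  parallel : ∀ {b c z w x y} → Arc b z x y → Arc c w x y → b ≡ c × z ≡ w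
  parallel {b} {c} {z} {w} {x} (arc p start step) (arc q start′ step′) =
    same-slot start start′ (difference-≋-injective b p c q (≋-cancelˡ (ι x) (≋-trans (≋-sym step) step′)))
    where
    same-slot : ∀ {b c p q} → point b z p ≡ x → point c w q ≡ x → b ≡ c × p ≡ q → b ≡ c × z ≡ w
    same-slot {b} {p = p} start start′ (refl , refl) =
      refl , point-translation-injective b p (trans start (sym start′))

  antiparallel : ∀ {b c z w x y} → Arc b z x y → ¬ Arc c w y x
  antiparallel {b} {c} {x = x} {y} (arc p _ step) (arc q _ step′) = difference-≋-neg b p c q
    (≋-resp (solve₁ (ι x) (difference b p) (difference c q)) (solve₂ (ι x) (difference c q))
      (+-≋ (≋-refl { - ι x - difference c q})
        (≋-trans (+-≋ʳ (difference c q) (≋-sym step)) (≋-sym step′))))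
    where
    solve₁ : ∀ x d d′ → - x - d′ + (x + d + d′) ≡ d
    solve₁ = solve-∀
    solve₂ : ∀ x d → - x - d + x ≡ - d
    solve₂ = solve-∀

  -- The residue y - x is a difference or the negative of one; the sign decides which way the arc
  -- runs, and `anchored` supplies the translate.
  arc-between : ∀ {x y} → x ≢ y → ∃₂ λ b z → Arc b z x y ⊎ Arc b z y x
  arc-between {x} {y} x≢y = build (represented {ι y - ι x} λ eq → x≢y (sym (ι-injective
      (≋-resp (restore (ι y) (ι x)) (ℤₚ.+-identityˡ (ι x)) (+-≋ʳ (ι x) eq)))))
    where
    restore : ∀ y x → y - x + x ≡ y
    restore = solve-∀
    solve₁ : ∀ x y d → y - x + (x + d) ≡ y + d
    solve₁ = solve-∀
    solve₂ : ∀ x d → - d + (x + d) ≡ x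
    solve₂ = solve-∀
    build : (∃₂ λ b p → ι y - ι x ≋ difference b p ⊎ ι y - ι x ≋ - difference b p) →
            ∃₂ λ b z → Arc b z x y ⊎ Arc b z y x
    build (b , p , inj₁ eq) = let z , start = anchored b p x in
      b , z , inj₁ (arc p start
        (≋-resp (restore (ι y) (ι x)) (ℤₚ.+-comm (difference b p) (ι x)) (+-≋ʳ (ι x) eq)))
    build (b , p , inj₂ eq) = let z , start = anchored b p y in
      b , z , inj₂ (arc p start
        (≋-sym (≋-resp (solve₁ (ι x) (ι y) (difference b p)) (solve₂ (ι x) (difference b p))
          (+-≋ʳ (ι x + difference b p) eq))))

  same-arc : ∀ {b c z w x y} → Arc b z x y ⊎ Arc b z y x → Arc c w x y ⊎ Arc c w y x → b ≡ c × z ≡ w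
  same-arc (inj₁ e) (inj₁ f) = parallel e f
  same-arc (inj₁ e) (inj₂ f) = contradiction f (antiparallel e)
  same-arc (inj₂ e) (inj₁ f) = contradiction f (antiparallel e)
  same-arc (inj₂ e) (inj₂ f) = parallel e f

  same-translate : ∀ {b c z w} → b ≡ c × z ≡ w → translate b z ≈ᶜ translate c w
  same-translate (refl , refl) = ≈ᶜ-refl

  isDesign-translates : IsDesign translates
  isDesign-translates = record
    { covered  = λ x y x≢y → let b , z , e = arc-between x≢y in
        Prop.lose (translate∈ b z) ([ proj₁ ∘ arc-edge , proj₂ ∘ arc-edge ]′ e)
    ; disjoint = λ B C B∈ C∈ x y e f → let
        b , z , B≈ = ∈-translates B∈
        c , w , C≈ = ∈-translates C∈
        in ≈ᶜ-trans B≈ (≈ᶜ-trans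
          (same-translate (same-arc (arcs (Equivalence.to (edges B≈ x y) e))
                                    (arcs (Equivalence.to (edges C≈ x y) f))))
          (≈ᶜ-sym C≈))
    }

  development : Design modulus 5
  development = design translates isDesign-translates

  translation-translate : ∀ w b z → translation w · translate b z ≈ᶜ translate b ⟦ ι z + ι w ⟧
  translation-translate w b z = ≗⇒≈ᶜ λ p → trans (translation-⟦⟧ w _) (⟦⟧-cong (≋-trans (+-≋ʳ (ι w) ι⟦ offset b p + ι z ⟧)
    (≋-trans (≋-reflexive (ℤₚ.+-assoc (offset b p) (ι z) (ι w)))
      (+-≋ (≋-refl {offset b p}) (≋-sym ι⟦ ι z + ι w ⟧)))))

  development-isCyclic : IsCyclic development
  development-isCyclic = Perm.id , λ w B B∈ → let b , z , B≈ = ∈-translates B∈ in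
    ≈⇒∈ b ⟦ ι z + ι w ⟧ (≈ᶜ-trans (≗⇒≈ᶜ λ _ → refl)
      (≈ᶜ-trans (·-congʳ (translation w) B≈) (translation-translate w b z)))

  development-path : ∀ b p a →
    Path development ⟦ a ⟧ ⟦ a + difference b p ⟧ ⟦ a + difference b p + difference b (next p) ⟧
  development-path b p a = through (anchored b p ⟦ a ⟧)
    where
    through : (∃ λ z → point b z p ≡ ⟦ a ⟧) →
      Path development ⟦ a ⟧ ⟦ a + difference b p ⟧ ⟦ a + difference b p + difference b (next p) ⟧
    through (z , start) = record
      { cycle    = translate b z
      ; member   = ≈⇒∈ b z ≈ᶜ-refl
      ; position = p
      ; first    = start
      ; second   = second
      ; third    = second-point b z (next p) second
          (≋-trans ι⟦ _ ⟧ (+-≋ʳ (difference b (next p)) (≋-sym ι⟦ a + difference b p ⟧)))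
      }
      where
      second : point b z (next p) ≡ ⟦ a + difference b p ⟧
      second = second-point b z p start (≋-trans ι⟦ _ ⟧ (+-≋ʳ (difference b p) (≋-sym ι⟦ a ⟧)))

-- Counting isomorphism classes.

module _ {v : ℕ} .{{_ : ℕ.NonZero v}} where
  open Residues v
  open Rigidity v

  private
    module classes = Inverse (proj₂ (isomorphismClasses v 5))

    representative : Fin (NC v 5) → Design v 5
    representative c = proj₁ (classes.from c)

  rigid⇒⊆ : ∀ {D E R : Design v 5} → Zigzag D → Zigzag E →
    ((π , _) : Isomorphic D R) ((ρ , _) : Isomorphic E R) →
    π ⟨$⟩ʳ ⟦ 0ℤ ⟧ ≡ ρ ⟨$⟩ʳ ⟦ 0ℤ ⟧ → π ⟨$⟩ʳ ⟦ 1ℤ ⟧ ≡ ρ ⟨$⟩ʳ ⟦ 1ℤ ⟧ → D ⊆ᵈ E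
  rigid⇒⊆ {D} {E} {R} zigD zigE I@(π , D⇔R) J@(ρ , E⇔R) at0 at1 B =
    Equivalence.from (E⇔R B)
    ∘ ∈-resp (·-congˡ {π = π} {ρ} (rigid {D} {E} {R} zigD zigE I J at0 at1) B)
    ∘ Equivalence.to (D⇔R B)

  -- Each design is encoded by its class and by the images of 0 and 1 under an isomorphism onto the
  -- class representative. Equal codes give two isomorphisms onto one representative that agree at 0
  -- and 1, hence everywhere by rigidity.
  family≤NC*v² : ∀ {M} (F : Fin M → CyclicDesign v 5) → (∀ f → Zigzag (proj₁ (F f))) →
    (∀ f g → proj₁ (F f) ⊆ᵈ proj₁ (F g) → f ≡ g) → M ℕ.≤ NC v 5 ℕ.* (v ℕ.* v)
  family≤NC*v² F zigzag distinct = Fin.injective⇒≤ {f = code} code-injective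
    where
    iso : ∀ f → Isomorphic (proj₁ (F f)) (representative (classes.to (F f)))
    iso f = IsEquivalence.sym Isomorphic-isEquivalence
      {representative (classes.to (F f))} {proj₁ (F f)} (classes.strictlyInverseʳ (F f))

    images : ∀ f → Fin (v ℕ.* v)
    images f = combine (proj₁ (iso f) ⟨$⟩ʳ ⟦ 0ℤ ⟧) (proj₁ (iso f) ⟨$⟩ʳ ⟦ 1ℤ ⟧)

    code : ∀ f → Fin (NC v 5 ℕ.* (v ℕ.* v))
    code f = combine (classes.to (F f)) (images f)

    -- Separate variables for the two classes allow matching on `refl`, after which both
    -- isomorphisms have the same target.
    same-class : ∀ {f g c d} → c ≡ d →
      ((π , _) : Isomorphic (proj₁ (F f)) (representative c))
      ((ρ , _) : Isomorphic (proj₁ (F g)) (representative d)) →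
      π ⟨$⟩ʳ ⟦ 0ℤ ⟧ ≡ ρ ⟨$⟩ʳ ⟦ 0ℤ ⟧ → π ⟨$⟩ʳ ⟦ 1ℤ ⟧ ≡ ρ ⟨$⟩ʳ ⟦ 1ℤ ⟧ → f ≡ g
    same-class {f} {g} {c} refl I J at0 at1 = distinct f g
      (rigid⇒⊆ {R = representative c} (zigzag f) (zigzag g) I J at0 at1)

    code-injective : Injective _≡_ _≡_ code
    code-injective {f} {g} eq =
      let class≡ , images≡ = Fin.combine-injective (classes.to (F f)) (images f) (classes.to (F g)) (images g) eq
          at0 , at1 = Fin.combine-injective (proj₁ (iso f) ⟨$⟩ʳ ⟦ 0ℤ ⟧) _ (proj₁ (iso g) ⟨$⟩ʳ ⟦ 0ℤ ⟧) _ images≡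
      in same-class class≡ (iso f) (iso g) at0 at1

-- Permutations encoded by numbers below m!.

lehmer : ∀ m → Fin (m !) → Permutation′ m
lehmer ℕ.zero    _ = Perm.id
lehmer (ℕ.suc m) k = let i , l = remQuot (m !) k in Perm.insert zero i (lehmer m l)

-- The image of 0 is the leading digit in factorial base; removing it leaves the permutation coded
-- by the remaining digits.
lehmer-injective : ∀ m k l → lehmer m k Perm.≈ lehmer m l → k ≡ l
lehmer-injective ℕ.zero    zero zero _ = refl
lehmer-injective (ℕ.suc m) k l eq = begin
  k                                ≡⟨ Fin.combine-remQuot {ℕ.suc m} (m !) k ⟨
  combine i p                      ≡⟨ cong₂ combine i≡j (lehmer-injective m p q p≈q) ⟩
  combine j q                      ≡⟨ Fin.combine-remQuot {ℕ.suc m} (m !) l ⟩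
  l                                ∎
  where
  open ≡-Reasoning
  i = proj₁ (remQuot {ℕ.suc m} (m !) k)
  p = proj₂ (remQuot {ℕ.suc m} (m !) k)
  j = proj₁ (remQuot {ℕ.suc m} (m !) l)
  q = proj₂ (remQuot {ℕ.suc m} (m !) l)
  i≡j : i ≡ j
  i≡j = eq zero
  p≈q : lehmer m p Perm.≈ lehmer m q
  p≈q x = Fin.punchIn-injective i _ _ (begin
    punchIn i (lehmer m p ⟨$⟩ʳ x)             ≡⟨ Perm.insert-punchIn zero i (lehmer m p) x ⟨
    lehmer (ℕ.suc m) k ⟨$⟩ʳ suc x             ≡⟨ eq (suc x) ⟩
    lehmer (ℕ.suc m) l ⟨$⟩ʳ suc x             ≡⟨ Perm.insert-punchIn zero j (lehmer m q) x ⟩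
    punchIn j (lehmer m q ⟨$⟩ʳ x)             ≡⟨ cong (λ h → punchIn h (lehmer m q ⟨$⟩ʳ x)) i≡j ⟨
    punchIn i (lehmer m q ⟨$⟩ʳ x)             ∎)

open import Data.Nat.Base using (_+_; _*_)

-- Factorials against exponentials, and powers of rationals.

n≤2^n : ∀ n → n ℕ.≤ 2 ℕ.^ n
n≤2^n ℕ.zero    = ℕ.z≤n
n≤2^n (ℕ.suc n) = begin
  1 + n                ≤⟨ ℕₚ.+-mono-≤ (ℕₚ.m^n>0 2 n) (n≤2^n n) ⟩
  2 ℕ.^ n + 2 ℕ.^ n    ≡⟨ cong (λ t → 2 ℕ.^ n + t) (ℕₚ.+-identityʳ (2 ℕ.^ n)) ⟨
  2 ℕ.^ ℕ.suc n        ∎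
  where open ℕₚ.≤-Reasoning

^-distribʳ-* : ∀ n a b → (a * b) ℕ.^ n ≡ a ℕ.^ n * b ℕ.^ n
^-distribʳ-* ℕ.zero    a b = refl
^-distribʳ-* (ℕ.suc n) a b = trans (cong (a * b *_) (^-distribʳ-* n a b)) (interchange a b (a ℕ.^ n) (b ℕ.^ n))
  where
  interchange : ∀ a b x y → a * b * (x * y) ≡ a * x * (b * y)
  interchange = ℕ-solve-∀

-- Each of the last j factors of the factorial is at least a.
a^j≤[j+a]! : ∀ a j → a ℕ.^ j ℕ.≤ (j + a) !
a^j≤[j+a]! a ℕ.zero    = ℕₚ.1≤n! a
a^j≤[j+a]! a (ℕ.suc j) = ℕₚ.*-mono-≤ (ℕₚ.m≤n+m a (ℕ.suc j)) (a^j≤[j+a]! a j)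

abstract
  -- With a = 2b and m = j + a, K b^m = (K b^a) b^j ≤ 2^j b^j = a^j ≤ m! as soon as K b^a ≤ j,
  -- because j ≤ 2^j. The block is `abstract` so that the enormous threshold is never evaluated.
  factorial-dominates : ∀ K b → ∃ λ N → ∀ m → N ℕ.≤ m → K * b ℕ.^ m ℕ.≤ m !
  factorial-dominates K b = C + a , bound
    where
    a : ℕ
    a = 2 * b
    C : ℕ
    C = K * b ℕ.^ a
    bound : ∀ m → C + a ℕ.≤ m → K * b ℕ.^ m ℕ.≤ m !
    bound m C+a≤m = subst (λ t → K * b ℕ.^ t ℕ.≤ t !) (ℕₚ.m∸n+n≡m (ℕₚ.m+n≤o⇒n≤o C C+a≤m)) (begin
      K * b ℕ.^ (j + a)          ≡⟨ cong (K *_) (ℕₚ.^-distribˡ-+-* b j a) ⟩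
      K * (b ℕ.^ j * b ℕ.^ a)    ≡⟨ cong (K *_) (ℕₚ.*-comm (b ℕ.^ j) (b ℕ.^ a)) ⟩
      K * (b ℕ.^ a * b ℕ.^ j)    ≡⟨ ℕₚ.*-assoc K (b ℕ.^ a) (b ℕ.^ j) ⟨
      C * b ℕ.^ j                ≤⟨ ℕₚ.*-monoˡ-≤ (b ℕ.^ j) (ℕₚ.≤-trans (ℕₚ.m+n≤o⇒m≤o∸n C C+a≤m) (n≤2^n j)) ⟩
      2 ℕ.^ j * b ℕ.^ j          ≡⟨ ^-distribʳ-* j 2 b ⟨
      a ℕ.^ j                    ≤⟨ a^j≤[j+a]! a j ⟩
      (j + a) !                  ∎)
      where
      open ℕₚ.≤-Reasoning
      j : ℕ
      j = m ℕ.∸ a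

-- Division by 1 normalises through a gcd that is stuck on a variable; the explicit fraction lets
-- products and comparisons compute.
fromℕ≡ : ∀ a → + a / 1 ≡ ℚ.mkℚ (+ a) 0 (Coprime.sym (Coprime.1-coprimeTo a))
fromℕ≡ a = ℚₚ.normalize-coprime (Coprime.sym (Coprime.1-coprimeTo a))

fromℕ-* : ∀ a b → (+ a / 1) ℚ.* (+ b / 1) ≡ + (a * b) / 1
fromℕ-* a b = trans (cong₂ ℚ._*_ (fromℕ≡ a) (fromℕ≡ b)) (cong (_/ 1) (sym (ℤₚ.pos-* a b)))

fromℕ-mono-≤ : ∀ {a b} → a ℕ.≤ b → + a / 1 ℚ.≤ + b / 1
fromℕ-mono-≤ {a} {b} a≤b = subst₂ ℚ._≤_ (sym (fromℕ≡ a)) (sym (fromℕ≡ b))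
  (ℚ.*≤* (ℤₚ.*-monoʳ-≤-nonNeg (+ 1) (ℤ.+≤+ a≤b)))

^-fromℕ-≤ : ∀ {q} k {{_ : ℚ.NonNegative q}} → q ℚ.≤ + k / 1 → ∀ n → q ^ n ℚ.≤ + (k ℕ.^ n) / 1
^-fromℕ-≤ k q≤k ℕ.zero = ℚₚ.≤-refl
^-fromℕ-≤ {q} k q≤k (ℕ.suc n) = begin
  q ℚ.* q ^ n                        ≤⟨ ℚₚ.*-monoˡ-≤-nonNeg q (^-fromℕ-≤ k q≤k n) ⟩
  q ℚ.* (+ (k ℕ.^ n) / 1)            ≤⟨ ℚₚ.*-monoʳ-≤-nonNeg (+ (k ℕ.^ n) / 1) {{ℚₚ.normalize-nonNeg (k ℕ.^ n) 1}} q≤k ⟩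
  (+ k / 1) ℚ.* (+ (k ℕ.^ n) / 1)    ≡⟨ fromℕ-* k (k ℕ.^ n) ⟩
  + (k * k ℕ.^ n) / 1                ∎
  where open ℚₚ.≤-Reasoning

-- The blocks and the intervals of their absolute values.

signed : ℤ → ℤ → ℤ → ℤ → ℤ → Fin 5 → ℤ
signed d₀ d₁ d₂ d₃ d₄ 0F = d₀
signed d₀ d₁ d₂ d₃ d₄ 1F = d₁
signed d₀ d₁ d₂ d₃ d₄ 2F = d₂
signed d₀ d₁ d₂ d₃ d₄ 3F = d₃
signed d₀ d₁ d₂ d₃ d₄ 4F = d₄

position : (ws : List ℕ) → Fin (length ws) → ℕ → ℕ
position (w ∷ ws) zero    r = r
position (w ∷ ws) (suc i) r = w + position ws i r

locate : ∀ (ws : List ℕ) k → k ℕ.< sum ws → ∃₂ λ i r → r ℕ.< lookup ws i × position ws i r ≡ k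
locate (w ∷ ws) k k<sum with k ℕₚ.<? w
... | yes k<w = zero , k , k<w , refl
... | no  k≮w = let i , r , r<w′ , eq = locate ws (k ℕ.∸ w) k∸w<sum in
  suc i , r , r<w′ , trans (cong (λ t → w + t) eq) w+[k∸w]≡k
  where
  w+[k∸w]≡k : w + (k ℕ.∸ w) ≡ k
  w+[k∸w]≡k = ℕₚ.m+[n∸m]≡n (ℕₚ.≮⇒≥ k≮w)
  k∸w<sum : k ℕ.∸ w ℕ.< sum ws
  k∸w<sum = ℕₚ.+-cancelˡ-< w _ _ (subst (ℕ._< w + sum ws) (sym w+[k∸w]≡k) k<sum)

-- For n = 2m + c the values 1, …, 5n are cut into twelve intervals of these lengths.  Blocks of the first kind
-- (j < m) consist of S + 2j, X₁ + f j, Y₁ + f j, P₁ + j′, Q₁ + j′ with j + j′ = m - 1 and f an arbitrary permutation;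
-- blocks of the second kind of S + 2j + 1, X₂ + j, Y₂ + j, P₂ + j, Q₂ + j.  The intervals Low, Mid and High are
-- left to c exceptional blocks, chosen below for c = 1 (n odd) and c = 2 (n even).
widths : ℕ → ℕ → List ℕ
widths c m = 2 * c ∷ m ∷ m ∷ m ∷ m ∷ m ∷ 2 * c ∷ 2 * m ∷ m ∷ m ∷ m ∷ c ∷ []

-- Shifted by one: the intervals tile 0, ..., 5n - 1, the absolute values are 1, ..., 5n.
value : ∀ c m → Fin 12 → ℕ → ℕ
value c m i r = ℕ.suc (position (widths c m) i r)

pattern Low  = 0F
pattern X₁   = 1F
pattern X₂   = 2F
pattern P₁   = 3F
pattern P₂   = 4F
pattern Q₁   = 5F
pattern Mid  = 6F
pattern S    = 7F
pattern Y₁   = 8F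
pattern Y₂   = 9F
pattern Q₂   = suc 9F
pattern High = suc (suc 9F)

record Core (c : ℕ) : Set where
  field
    coreDifference : ℕ → Fin c → Fin 5 → ℤ
    coreClosed     : ∀ m i → ∃ λ q → total (coreDifference m i) ≡ q ℤ.* + (10 * (m + (m + c)) + 1)
    coreLow        : ∀ m r → r ℕ.< 2 * c → ∃₂ λ i p → ∣ coreDifference m i p ∣ ≡ value c m Low r
    coreMid        : ∀ m r → r ℕ.< 2 * c → ∃₂ λ i p → ∣ coreDifference m i p ∣ ≡ value c m Mid r
    coreHigh       : ∀ m r → r ℕ.< c → ∃₂ λ i p → ∣ coreDifference m i p ∣ ≡ value c m High r
    zigzag         : ∃₂ λ i p → ∀ m → coreDifference m i p ≡ + 1 × coreDifference m i (next p) ≡ - + 2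

-- This and the next two lemmas treat the three sign patterns in use. Moving the negative terms
-- across leaves an identity of natural numbers for the ring solver.
balanced : ∀ s x y p q {w} → s + y + p + q ≡ w + x →
  total (signed (+ s) (- + x) (+ y) (+ p) (+ q)) ≡ 1ℤ ℤ.* + w
balanced s x y p q {w} eq = trans (regroup (+ s) (+ x) (+ y) (+ p) (+ q))
  (trans (cong (λ t → + t ℤ.- + x) eq) (cancel (+ w) (+ x)))
  where
  regroup : ∀ s x y p q → s ℤ.+ (- x ℤ.+ (y ℤ.+ (p ℤ.+ q))) ≡ s ℤ.+ y ℤ.+ p ℤ.+ q ℤ.- x
  regroup = solve-∀
  cancel : ∀ w x → w ℤ.+ x ℤ.- x ≡ 1ℤ ℤ.* w
  cancel = solve-∀

balanced₀ : ∀ s x y p q w → s + y ≡ x + p + q →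
  total (signed (+ s) (- + x) (+ y) (- + p) (- + q)) ≡ 0ℤ ℤ.* + w
balanced₀ s x y p q w eq = trans (regroup (+ s) (+ x) (+ y) (+ p) (+ q))
  (trans (cong (λ t → + t ℤ.- (+ x ℤ.+ + p ℤ.+ + q)) eq) (ℤₚ.+-inverseʳ (+ (x + p + q))))
  where
  regroup : ∀ s x y p q → s ℤ.+ (- x ℤ.+ (y ℤ.+ (- p ℤ.+ - q))) ≡ s ℤ.+ y ℤ.- (x ℤ.+ p ℤ.+ q)
  regroup = solve-∀

balanced₁ : ∀ s x y p q w → s + y + p ≡ x + q →
  total (signed (+ s) (- + x) (+ y) (+ p) (- + q)) ≡ 0ℤ ℤ.* + w
balanced₁ s x y p q w eq = trans (regroup (+ s) (+ x) (+ y) (+ p) (+ q))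
  (trans (cong (λ t → + t ℤ.- (+ x ℤ.+ + q)) eq) (ℤₚ.+-inverseʳ (+ (x + q))))
  where
  regroup : ∀ s x y p q → s ℤ.+ (- x ℤ.+ (y ℤ.+ (p ℤ.+ - q))) ≡ s ℤ.+ y ℤ.+ p ℤ.- (x ℤ.+ q)
  regroup = solve-∀

halve : ∀ r → ∃ λ j → r ≡ 2 * j ⊎ r ≡ 1 + 2 * j
halve ℕ.zero = 0 , inj₁ refl
halve (ℕ.suc r) with halve r
... | j , inj₁ refl = j , inj₂ refl
... | j , inj₂ refl = ℕ.suc j , inj₁ (sym (ℕₚ.*-suc 2 j))

module Construction (c : ℕ) (core : Core c) (m : ℕ) where
  open Core core

  n : ℕ
  n = m + (m + c)

  val : Fin 12 → ℕ → ℕ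
  val = value c m

  Blocks : Set
  Blocks = Fin m ⊎ (Fin m ⊎ Fin c)

  module _ (π : Permutation′ m) where
    differences : Blocks → Fin 5 → ℤ
    differences (inj₁ j) = signed (+ val S (2 * toℕ j)) (- + val X₁ (toℕ (π ⟨$⟩ʳ j)))
      (+ val Y₁ (toℕ (π ⟨$⟩ʳ j))) (+ val P₁ (toℕ (opposite j))) (+ val Q₁ (toℕ (opposite j)))
    differences (inj₂ (inj₁ j)) = signed (+ val S (1 + 2 * toℕ j)) (- + val X₂ (toℕ j))
      (+ val Y₂ (toℕ j)) (- + val P₂ (toℕ j)) (- + val Q₂ (toℕ j))
    differences (inj₂ (inj₂ i)) = coreDifference m i

    opposite-sum : ∀ (j : Fin m) → m ≡ toℕ j + ℕ.suc (toℕ (opposite j))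
    opposite-sum j = sym (trans (cong (λ t → toℕ j + ℕ.suc t) (Fin.opposite-prop j))
      (trans (ℕₚ.+-suc (toℕ j) _) (ℕₚ.m+[n∸m]≡n (Fin.toℕ<n j))))

    -- The increment 2j in `S` is compensated by the reversed positions in `P₁` and `Q₁`, as j +
    -- `opposite j` = m - 1. The gap between the `X₁` and `Y₁` entries is constant, so π cancels.
    closed₁ : ∀ j →
      val S (2 * toℕ j) + val Y₁ (toℕ (π ⟨$⟩ʳ j)) + val P₁ (toℕ (opposite j)) + val Q₁ (toℕ (opposite j))
      ≡ 10 * n + 1 + val X₁ (toℕ (π ⟨$⟩ʳ j))
    closed₁ j = solve (toℕ j) (toℕ (opposite j)) (toℕ (π ⟨$⟩ʳ j)) m (opposite-sum j)
      where
      solve : ∀ j k f m → m ≡ j + ℕ.suc k →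
        value c m S (2 * j) + value c m Y₁ f + value c m P₁ k + value c m Q₁ k
        ≡ 10 * (m + (m + c)) + 1 + value c m X₁ f
      solve j k f m refl = identity c j k f
        where
        -- The values are written out because the ring solver does not unfold value.
        identity : ∀ c j k f →
          (1 + (2 * c + ((j + (1 + k)) + ((j + (1 + k)) + ((j + (1 + k)) + ((j + (1 + k)) + ((j + (1 + k)) + (2 * c + 2 * j))))))))
          + (1 + (2 * c + ((j + (1 + k)) + ((j + (1 + k)) + ((j + (1 + k)) + ((j + (1 + k)) + ((j + (1 + k)) + (2 * c + (2 * (j + (1 + k)) + f)))))))))
          + (1 + (2 * c + ((j + (1 + k)) + ((j + (1 + k)) + k))))
          + (1 + (2 * c + ((j + (1 + k)) + ((j + (1 + k)) + ((j + (1 + k)) + ((j + (1 + k)) + k))))))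
          ≡ 10 * ((j + (1 + k)) + ((j + (1 + k)) + c)) + 1 + (1 + (2 * c + f))
        identity = ℕ-solve-∀

    -- Here j balances as 2j + j = j + j + j.
    closed₂ : ∀ j → val S (1 + 2 * j) + val Y₂ j ≡ val X₂ j + val P₂ j + val Q₂ j
    closed₂ j = identity c m j
      where
      identity : ∀ c m j →
        (1 + (2 * c + (m + (m + (m + (m + (m + (2 * c + (1 + 2 * j)))))))))
        + (1 + (2 * c + (m + (m + (m + (m + (m + (2 * c + (2 * m + (m + j))))))))))
        ≡ (1 + (2 * c + (m + j)))
        + (1 + (2 * c + (m + (m + (m + j)))))
        + (1 + (2 * c + (m + (m + (m + (m + (m + (2 * c + (2 * m + (m + (m + j)))))))))))
      identity = ℕ-solve-∀

    closed : ∀ b → ∃ λ q → total (differences b) ≡ q ℤ.* + (10 * n + 1)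
    closed (inj₁ j)        = 1ℤ , balanced (val S (2 * toℕ j)) (val X₁ (toℕ (π ⟨$⟩ʳ j))) (val Y₁ (toℕ (π ⟨$⟩ʳ j)))
                               (val P₁ (toℕ (opposite j))) (val Q₁ (toℕ (opposite j))) (closed₁ j)
    closed (inj₂ (inj₁ j)) = 0ℤ , balanced₀ (val S (1 + 2 * toℕ j)) (val X₂ (toℕ j)) (val Y₂ (toℕ j))
                               (val P₂ (toℕ j)) (val Q₂ (toℕ j)) (10 * n + 1) (closed₂ (toℕ j))
    closed (inj₂ (inj₂ i)) = coreClosed m i

    at : ∀ {r} (r<m : r ℕ.< m) i → val i (toℕ (fromℕ< r<m)) ≡ val i r
    at r<m i = cong (val i) (Fin.toℕ-fromℕ< r<m)

    at-π : ∀ {r} (r<m : r ℕ.< m) i → val i (toℕ (π ⟨$⟩ʳ (π ⟨$⟩ˡ fromℕ< r<m))) ≡ val i r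
    at-π r<m i = trans (cong (val i ∘ toℕ) (Perm.inverseʳ π)) (at r<m i)

    at-opposite : ∀ {r} (r<m : r ℕ.< m) i → val i (toℕ (opposite (opposite (fromℕ< r<m)))) ≡ val i r
    at-opposite r<m i = trans (cong (val i ∘ toℕ) (Fin.opposite-involutive (fromℕ< r<m))) (at r<m i)

    covers-interval : ∀ i r → r ℕ.< lookup (widths c m) i → ∃₂ λ b p → ∣ differences b p ∣ ≡ val i r
    covers-interval Low  r r<2c = let i , p , eq = coreLow m r r<2c in inj₂ (inj₂ i) , p , eq
    -- The block containing the r-th value is found through the inverse of π.
    covers-interval X₁   r r<m  = inj₁ (π ⟨$⟩ˡ fromℕ< r<m) , 1F , at-π r<m X₁
    covers-interval X₂   r r<m  = inj₂ (inj₁ (fromℕ< r<m)) , 1F , at r<m X₂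
    covers-interval P₁   r r<m  = inj₁ (opposite (fromℕ< r<m)) , 3F , at-opposite r<m P₁
    covers-interval P₂   r r<m  = inj₂ (inj₁ (fromℕ< r<m)) , 3F , at r<m P₂
    covers-interval Q₁   r r<m  = inj₁ (opposite (fromℕ< r<m)) , 4F , at-opposite r<m Q₁
    covers-interval Mid  r r<2c = let i , p , eq = coreMid m r r<2c in inj₂ (inj₂ i) , p , eq
    covers-interval S    r r<2m with halve r
    ... | j , inj₁ refl = inj₁ (fromℕ< j<m) , 0F , cong (λ t → val S (2 * t)) (Fin.toℕ-fromℕ< j<m)
      where
      j<m : j ℕ.< m
      j<m = ℕₚ.*-cancelˡ-< 2 j m r<2m
    ... | j , inj₂ refl = inj₂ (inj₁ (fromℕ< j<m)) , 0F , cong (λ t → val S (1 + 2 * t)) (Fin.toℕ-fromℕ< j<m)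
      where
      j<m : j ℕ.< m
      j<m = ℕₚ.*-cancelˡ-< 2 j m (ℕₚ.<-trans (ℕₚ.n<1+n (2 * j)) r<2m)
    covers-interval Y₁   r r<m  = inj₁ (π ⟨$⟩ˡ fromℕ< r<m) , 2F , at-π r<m Y₁
    covers-interval Y₂   r r<m  = inj₂ (inj₁ (fromℕ< r<m)) , 2F , at r<m Y₂
    covers-interval Q₂   r r<m  = inj₂ (inj₁ (fromℕ< r<m)) , 4F , at r<m Q₂
    covers-interval High r r<c  = let i , p , eq = coreHigh m r r<c in inj₂ (inj₂ i) , p , eq

    sum-widths : 5 * n ≡ sum (widths c m)
    sum-widths = identity c m
      where
      identity : ∀ c m → 5 * (m + (m + c)) ≡ 2 * c + (m + (m + (m + (m + (m + (2 * c + (2 * m + (m + (m + (m + (c + 0)))))))))))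
      identity = ℕ-solve-∀

    family : DifferenceFamily n
    family = record
      { Block      = Blocks
      ; index      = ↔-trans (↔-refl ⊎-↔ ↔-sym Fin.+↔⊎) (↔-sym Fin.+↔⊎)
      ; difference = differences
      ; closed     = closed
      ; covers     = λ k →
          let i , r , r<w , eq = locate (widths c m) (toℕ k) (subst (toℕ k ℕ.<_) sum-widths (Fin.toℕ<n k))
              b , p , ∣d∣ = covers-interval i r r<w
          in b , p , trans ∣d∣ (cong ℕ.suc eq)
      }

    open Development family public using (development; development-isCyclic; development-path; small-≋; ∣difference∣≤5n)

  open Residues (10 * n + 1) {{ℕ.≢-nonZero (ℕₚ.m+1+n≢0 (10 * n))}}
  open Rigidity (10 * n + 1) {{ℕ.≢-nonZero (ℕₚ.m+1+n≢0 (10 * n))}}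

  development-zigzag : ∀ π → Zigzag (development π)
  development-zigzag π a = let i , p , eq = zigzag ; d≡ , d′≡ = eq m in
    turn d≡ d′≡ (development-path π (inj₂ (inj₂ i)) p a)
    where
    turn : ∀ {d d′} → d ≡ + 1 → d′ ≡ - + 2 →
      Path (development π) ⟦ a ⟧ ⟦ a ℤ.+ d ⟧ ⟦ a ℤ.+ d ℤ.+ d′ ⟧ →
      Path (development π) ⟦ a ⟧ ⟦ a ℤ.+ 1ℤ ⟧ ⟦ a ℤ.- 1ℤ ⟧
    turn refl refl = subst (Path (development π) ⟦ a ⟧ ⟦ a ℤ.+ 1ℤ ⟧) (cong ⟦_⟧ (ℤₚ.+-assoc a (+ 1) (- + 2)))

  -- The cycle through the edge {0, s} continues to s - x, so the cycle set determines x.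
  development-distinct : ∀ π ρ → development π ⊆ᵈ development ρ → π Perm.≈ ρ
  development-distinct π ρ π⊆ρ j = Fin.toℕ-injective (ℕₚ.+-cancelˡ-≡ (2 * c) _ _
    (ℕₚ.suc-injective (ℤₚ.+-injective (ℤₚ.neg-injective x≡))))
    where
    b : Blocks
    b = inj₁ j
    a : ℤ
    a = 0ℤ ℤ.+ (+ val S (2 * toℕ j))
    thirds : ⟦ a ℤ.+ differences π b 1F ⟧ ≡ ⟦ a ℤ.+ differences ρ b 1F ⟧
    thirds = path-unique {D = development ρ}
      (path-mono {D = development π} {development ρ} π⊆ρ (development-path π b 0F 0ℤ))
      (development-path ρ b 0F 0ℤ)
    x≡ : differences π b 1F ≡ differences ρ b 1F
    x≡ = small-≋ π (∣difference∣≤5n π b 1F) (∣difference∣≤5n ρ b 1F) (≋-cancelˡ a (⟦⟧-injective thirds))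

  m!≤NC*v² : m ! ℕ.≤ NC (10 * n + 1) 5 * ((10 * n + 1) * (10 * n + 1))
  m!≤NC*v² = family≤NC*v² {10 * n + 1} {{ℕ.≢-nonZero (ℕₚ.m+1+n≢0 (10 * n))}}
    (λ k → development (lehmer m k) , development-isCyclic (lehmer m k))
    (λ k → development-zigzag (lehmer m k))
    (λ k l k⊆l → lehmer-injective m k l (development-distinct (lehmer m k) (lehmer m l) k⊆l))

-- Exceptional blocks for odd and for even n.

core₁ : Core 1
core₁ = record
  { coreDifference = λ { m 0F → block m }
  ; coreClosed     = λ { m 0F → 1ℤ ,
      balanced 1 2 (value 1 m Mid 0) (value 1 m Mid 1) (value 1 m High 0) (identity m) }
  ; coreLow        = λ { m 0 _ → 0F , 0F , refl ; m 1 _ → 0F , 1F , refl ; m (ℕ.suc (ℕ.suc _)) (ℕ.s≤s (ℕ.s≤s ())) }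
  ; coreMid        = λ { m 0 _ → 0F , 2F , refl ; m 1 _ → 0F , 3F , refl ; m (ℕ.suc (ℕ.suc _)) (ℕ.s≤s (ℕ.s≤s ())) }
  ; coreHigh       = λ { m 0 _ → 0F , 4F , refl ; m (ℕ.suc _) (ℕ.s≤s ()) }
  ; zigzag         = 0F , 0F , λ m → refl , refl
  }
  where
  block : ℕ → Fin 5 → ℤ
  -- The entries are 1, -2, 5m + 3, 5m + 4, 10m + 5, with sum 20m + 11, the modulus for n = 2m + 1.
  block m = signed (+ 1) (- + 2) (+ value 1 m Mid 0) (+ value 1 m Mid 1) (+ value 1 m High 0)
  identity : ∀ m →
    1
    + (1 + (2 * 1 + (m + (m + (m + (m + (m + 0)))))))
    + (1 + (2 * 1 + (m + (m + (m + (m + (m + 1)))))))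
    + (1 + (2 * 1 + (m + (m + (m + (m + (m + (2 * 1 + (2 * m + (m + (m + (m + 0))))))))))))
    ≡ 10 * (m + (m + 1)) + 1 + 2
  identity = ℕ-solve-∀

core₂ : Core 2
core₂ = record
  { coreDifference = λ { m 0F → block₀ m ; m 1F → block₁ m }
  ; coreClosed     = λ { m 0F → 0ℤ ,
      balanced₁ 1 2 3 (value 2 m Mid 0) (value 2 m Mid 2) (10 * (m + (m + 2)) + 1) (identity₀ m)
                       ; m 1F → 1ℤ ,
      balanced 4 (value 2 m Mid 3) (value 2 m Mid 1) (value 2 m High 0) (value 2 m High 1) (identity₁ m) }
  ; coreLow        = λ { m 0 _ → 0F , 0F , refl ; m 1 _ → 0F , 1F , refl
                       ; m 2 _ → 0F , 2F , refl ; m 3 _ → 1F , 0F , refl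
                       ; m (ℕ.suc (ℕ.suc (ℕ.suc (ℕ.suc _)))) (ℕ.s≤s (ℕ.s≤s (ℕ.s≤s (ℕ.s≤s ())))) }
  ; coreMid        = λ { m 0 _ → 0F , 3F , refl ; m 1 _ → 1F , 2F , refl
                       ; m 2 _ → 0F , 4F , refl ; m 3 _ → 1F , 1F , refl
                       ; m (ℕ.suc (ℕ.suc (ℕ.suc (ℕ.suc _)))) (ℕ.s≤s (ℕ.s≤s (ℕ.s≤s (ℕ.s≤s ())))) }
  ; coreHigh       = λ { m 0 _ → 1F , 3F , refl ; m 1 _ → 1F , 4F , refl ; m (ℕ.suc (ℕ.suc _)) (ℕ.s≤s (ℕ.s≤s ())) }
  ; zigzag         = 0F , 0F , λ m → refl , refl
  }
  where
  block₀ : ℕ → Fin 5 → ℤ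
  -- The entries are 1, -2, 3, 5m + 5, -(5m + 7), with sum 0.
  block₀ m = signed (+ 1) (- + 2) (+ 3) (+ value 2 m Mid 0) (- + value 2 m Mid 2)
  block₁ : ℕ → Fin 5 → ℤ
  -- The entries are 4, -(5m + 8), 5m + 6, 10m + 9, 10m + 10, with sum 20m + 21, the modulus for n =
  -- 2m + 2.
  block₁ m = signed (+ 4) (- + value 2 m Mid 3) (+ value 2 m Mid 1) (+ value 2 m High 0) (+ value 2 m High 1)
  identity₀ : ∀ m → 1 + 3 + (1 + (2 * 2 + (m + (m + (m + (m + (m + 0))))))) ≡ 2 + (1 + (2 * 2 + (m + (m + (m + (m + (m + 2)))))))
  identity₀ = ℕ-solve-∀
  identity₁ : ∀ m →
    4
    + (1 + (2 * 2 + (m + (m + (m + (m + (m + 1)))))))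
    + (1 + (2 * 2 + (m + (m + (m + (m + (m + (2 * 2 + (2 * m + (m + (m + (m + 0))))))))))))
    + (1 + (2 * 2 + (m + (m + (m + (m + (m + (2 * 2 + (2 * m + (m + (m + (m + 1))))))))))))
    ≡ 10 * (m + (m + 2)) + 1 + (1 + (2 * 2 + (m + (m + (m + (m + (m + 3)))))))
  identity₁ = ℕ-solve-∀

-- Comparison of m! with 39^n times the squared modulus.

module Estimate (c m : ℕ) (c≤2 : c ℕ.≤ 2) where
  private
    n w : ℕ
    n = m + (m + c)
    w = 10 * n + 1

  w≤41*2^m : w ℕ.≤ 41 * 2 ℕ.^ m
  w≤41*2^m = begin
    10 * (m + (m + c)) + 1          ≤⟨ ℕₚ.+-monoˡ-≤ 1 (ℕₚ.*-monoʳ-≤ 10 (ℕₚ.+-monoʳ-≤ m (ℕₚ.+-monoʳ-≤ m c≤2))) ⟩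
    10 * (m + (m + 2)) + 1          ≡⟨ solve₁ m ⟩
    20 * m + 21 * 1                 ≤⟨ ℕₚ.+-mono-≤ (ℕₚ.*-monoʳ-≤ 20 (n≤2^n m)) (ℕₚ.*-monoʳ-≤ 21 (ℕₚ.m^n>0 2 m)) ⟩
    20 * 2 ℕ.^ m + 21 * 2 ℕ.^ m     ≡⟨ ℕₚ.*-distribʳ-+ (2 ℕ.^ m) 20 21 ⟨
    41 * 2 ℕ.^ m                    ∎
    where
    open ℕₚ.≤-Reasoning
    solve₁ : ∀ m → 10 * (m + (m + 2)) + 1 ≡ 20 * m + 21 * 1
    solve₁ = ℕ-solve-∀

  39^n≤ : 39 ℕ.^ n ℕ.≤ 39 ℕ.^ m * (39 ℕ.^ m * 1521)
  39^n≤ = begin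
    39 ℕ.^ (m + (m + c))                      ≤⟨ ℕₚ.^-monoʳ-≤ 39 (ℕₚ.+-monoʳ-≤ m (ℕₚ.+-monoʳ-≤ m c≤2)) ⟩
    39 ℕ.^ (m + (m + 2))                      ≡⟨ ℕₚ.^-distribˡ-+-* 39 m (m + 2) ⟩
    39 ℕ.^ m * 39 ℕ.^ (m + 2)                 ≡⟨ cong (λ t → 39 ℕ.^ m * t) (ℕₚ.^-distribˡ-+-* 39 m 2) ⟩
    39 ℕ.^ m * (39 ℕ.^ m * 1521)              ∎
    where open ℕₚ.≤-Reasoning

  6084^m : 6084 ℕ.^ m ≡ (39 ℕ.^ m * 39 ℕ.^ m) * (2 ℕ.^ m * 2 ℕ.^ m)
  6084^m = trans (^-distribʳ-* m 1521 4) (cong₂ _*_ (^-distribʳ-* m 39 39) (^-distribʳ-* m 2 2))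

  -- The base 6084 = 39² · 2² collects two factors 39^m from 39^n and two factors 2^m from w². The
  -- constant 1521 = 39² accounts for c ≤ 2, and 41 comes from w ≤ 20m + 21.
  39^n*w²≤ : 39 ℕ.^ n * (w * w) ℕ.≤ 1521 * (41 * 41) * 6084 ℕ.^ m
  39^n*w²≤ = begin
    39 ℕ.^ n * (w * w)
      ≤⟨ ℕₚ.*-mono-≤ 39^n≤ (ℕₚ.*-mono-≤ w≤41*2^m w≤41*2^m) ⟩
    39 ℕ.^ m * (39 ℕ.^ m * 1521) * (41 * 2 ℕ.^ m * (41 * 2 ℕ.^ m))
      ≡⟨ regroup 1521 41 (39 ℕ.^ m) (2 ℕ.^ m) ⟩
    1521 * (41 * 41) * ((39 ℕ.^ m * 39 ℕ.^ m) * (2 ℕ.^ m * 2 ℕ.^ m))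
      ≡⟨ cong (λ t → 1521 * (41 * 41) * t) 6084^m ⟨
    1521 * (41 * 41) * 6084 ℕ.^ m
      ∎
    where
    open ℕₚ.≤-Reasoning
    regroup : ∀ a b x y → x * (x * a) * (b * y * (b * y)) ≡ a * (b * b) * ((x * x) * (y * y))
    regroup = ℕ-solve-∀

threshold : ∃ λ N → ∀ m → N ℕ.≤ m → 1521 * (41 * 41) * 6084 ℕ.^ m ℕ.≤ m !
threshold = factorial-dominates (1521 * (41 * 41)) 6084

core⇒39^n≤NC : ∀ c → Core c → c ℕ.≤ 2 → ∀ m → proj₁ threshold ℕ.≤ m →
  39 ℕ.^ (m + (m + c)) ℕ.≤ NC (10 * (m + (m + c)) + 1) 5
core⇒39^n≤NC c core c≤2 m N≤m = ℕₚ.*-cancelʳ-≤ _ _ (w * w) {{w²≢0}}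
  (ℕₚ.≤-trans (Estimate.39^n*w²≤ c m c≤2) (ℕₚ.≤-trans (proj₂ threshold m N≤m) (Construction.m!≤NC*v² c core m)))
  where
  w : ℕ
  w = 10 * (m + (m + c)) + 1
  w≢0 : ℕ.NonZero w
  w≢0 = ℕ.≢-nonZero (ℕₚ.m+1+n≢0 (10 * (m + (m + c))))
  w²≢0 : ℕ.NonZero (w * w)
  w²≢0 = ℕₚ.m*n≢0 w w {{w≢0}} {{w≢0}}

half-large : ∀ {N m c} → c ℕ.≤ 2 → N + (N + 2) ℕ.≤ m + (m + c) → N ℕ.≤ m
half-large {N} {m} c≤2 large = ℕₚ.≮⇒≥ λ m<N →
  ℕₚ.<⇒≱ (ℕₚ.+-mono-<-≤ m<N (ℕₚ.+-mono-≤ (ℕₚ.<⇒≤ m<N) c≤2)) large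

decomposed⇒39^n≤NC : ∀ {c n} m → m + (m + c) ≡ n → Core c → c ℕ.≤ 2 →
  n ℕ.≥ proj₁ threshold + (proj₁ threshold + 2) → 39 ℕ.^ n ℕ.≤ NC (10 * n + 1) 5
decomposed⇒39^n≤NC {c} m refl core c≤2 large = core⇒39^n≤NC c core c≤2 m (half-large c≤2 large)

39^n≤NC : ∀ n → n ℕ.> 1 → n ℕ.≥ proj₁ threshold + (proj₁ threshold + 2) → 39 ℕ.^ n ℕ.≤ NC (10 * n + 1) 5
-- Halving n - 1 rather than n gives c = 1 or c = 2, so there is always an exceptional block to
-- carry 1, -2.
39^n≤NC (ℕ.suc r) _ large with halve r
... | j , inj₁ refl = decomposed⇒39^n≤NC j (solve j) core₁ (ℕ.s≤s ℕ.z≤n) large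
  where
  solve : ∀ j → j + (j + 1) ≡ 1 + 2 * j
  solve = ℕ-solve-∀
... | j , inj₂ refl = decomposed⇒39^n≤NC j (solve j) core₂ ℕₚ.≤-refl large
  where
  solve : ∀ j → j + (j + 2) ≡ 2 + 2 * j
  solve = ℕ-solve-∀

proposition5 : ∃ λ (N : ℕ) → ∀ (n : ℕ) → n ℕ.> 1 → n ℕ.≥ N →
    (n % 7 ≢ 4 → (+ NC (10 * n + 1) 5 / 1) ℚ.≥ (+ 297 / 10) ^ n) ×
    (n % 7 ≡ 4 → (+ NC (10 * n + 1) 5 / 1) ℚ.≥ (+ 384 / 10) ^ n)
proposition5 = proj₁ threshold + (proj₁ threshold + 2) , λ n n>1 n≥N →
  -- Both 29.7 and 38.4 lie below 39.
  let 39^n≤ = fromℕ-mono-≤ (39^n≤NC n n>1 n≥N) in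
    (λ _ → ℚₚ.≤-trans (^-fromℕ-≤ 39 (from-yes ((+ 297 / 10) ℚₚ.≤? + 39 / 1)) n) 39^n≤)
  , (λ _ → ℚₚ.≤-trans (^-fromℕ-≤ 39 (from-yes ((+ 384 / 10) ℚₚ.≤? + 39 / 1)) n) 39^n≤)
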